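{- The number $4/9$ is a non-jump for $3$-uniform hypergraphs.
   Context: A $3$-graph is a set of $3$-element subsets (edges) of a finite vertex set; $|H|$ denotes its number of edges. For a family $\mathcal F$ of $3$-graphs, $\operatorname{ex}(n,\mathcal F)$ is the maximum number of edges in an $n$-vertex $3$-graph containing no member of $\mathcal F$ as a subgraph, and the Turán density is $\pi(\mathcal F)=\lim_{n\to\infty}\operatorname{ex}(n,\mathcal F)/\binom n3$. Let $\Pi^{(3)}_\infty$ be the set of all Turán densities $\pi(\mathcal F)$ of non-empty, possibly infinite, families $\mathcal F$ of $3$-graphs. A number $\alpha\in[0,1)$ is a jump for $3$-graphs if there exists $c>0$ with $\Pi^{(3)}_\infty\cap(\alpha,\alpha+c)=\emptyset$; otherwise $\alpha$ is a non-jump. -}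

module Defs where

open import Level using (Level; 0ℓ) renaming (suc to lsuc)
open import Data.Nat as ℕ using (ℕ)
open import Data.Nat.Combinatorics using (_C_)
open import Data.Fin using (Fin) renaming (_<_ to _<ᶠ_)
open import Data.Integer using (+_)
open import Data.Rational using (ℚ; _/_; _+_; _*_; _≤_; _<_; 0ℚ)
open import Data.Product using (Σ; Σ-syntax; _×_; _,_)
open import Data.Sum using (_⊎_)
open import Data.List using (List; length)
open import Data.List.Relation.Unary.All using (All)
open import Data.List.Relation.Unary.Any using (Any)
open import Data.List.Relation.Unary.Unique.Propositional using (Unique)
open import Relation.Binary.PropositionalEquality using (_≡_)
open import Relation.Nullary using (¬_)
open import Function.Definitions using (Injective)

ℕ→ℚ : ℕ → ℚ
ℕ→ℚ n = + n / 1

Triple : ℕ → Set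
Triple v = Fin v × Fin v × Fin v

-- a triple (a , b , c) with a < b < c encodes the 3-element set {a,b,c}
Increasing : {v : ℕ} → Triple v → Set
Increasing (a , b , c) = (a <ᶠ b) × (b <ᶠ c)

-- A 3-graph on vertex set Fin v: a duplicate-free list of 3-element subsets,
-- each written as its increasingly sorted triple.
record Graph3 (v : ℕ) : Set where
  field
    edges      : List (Triple v)
    increasing : All Increasing edges
    distinct   : Unique edges
open Graph3 public

∣_∣ₑ : {v : ℕ} → Graph3 v → ℕ
∣ H ∣ₑ = length (edges H)

SameSet : {v : ℕ} → Triple v → Triple v → Set
SameSet (x , y , z) (a , b , c) =
  ((x ≡ a) × (y ≡ b) × (z ≡ c)) ⊎ ((x ≡ a) × (y ≡ c) × (z ≡ b)) ⊎
  ((x ≡ b) × (y ≡ a) × (z ≡ c)) ⊎ ((x ≡ b) × (y ≡ c) × (z ≡ a)) ⊎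
  ((x ≡ c) × (y ≡ a) × (z ≡ b)) ⊎ ((x ≡ c) × (y ≡ b) × (z ≡ a))

HasEdge : {v : ℕ} → Graph3 v → Fin v → Fin v → Fin v → Set
HasEdge H x y z = Any (SameSet (x , y , z)) (edges H)

Contains : {n k : ℕ} → Graph3 n → Graph3 k → Set
Contains {n} {k} H G =
  Σ[ f ∈ (Fin k → Fin n) ] Injective _≡_ _≡_ f ×
    All (λ { (a , b , c) → HasEdge H (f a) (f b) (f c) }) (edges G)

Family : Set₁
Family = (k : ℕ) → Graph3 k → Set

NonEmpty : Family → Set
NonEmpty 𝓕 = Σ[ k ∈ ℕ ] Σ[ G ∈ Graph3 k ] 𝓕 k G

Free : Family → {n : ℕ} → Graph3 n → Set
Free 𝓕 H = (k : ℕ) (G : Graph3 k) → 𝓕 k G → ¬ Contains H G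

-- "π(𝓕) lies in the open interval (a , b)".
-- Since the limit π(𝓕) = lim ex(n,𝓕)/C(n,3) always exists, it lies in (a,b)
-- iff there are rationals a < q₁, q₂ < b with q₁ ≤ ex(n,𝓕)/C(n,3) ≤ q₂ for
-- all large n.  "q₁·C(n,3) ≤ ex(n,𝓕)" is witnessed by an 𝓕-free 3-graph on
-- n vertices with that many edges; "ex(n,𝓕) ≤ q₂·C(n,3)" says every 𝓕-free
-- 3-graph on n vertices has at most that many edges.
TuranDensityIn : Family → ℚ → ℚ → Set
TuranDensityIn 𝓕 a b =
  Σ[ q₁ ∈ ℚ ] Σ[ q₂ ∈ ℚ ] Σ[ N ∈ ℕ ]
    (a < q₁) × (q₂ < b) ×
    ((n : ℕ) → N ℕ.≤ n →
      (Σ[ H ∈ Graph3 n ] Free 𝓕 H × (q₁ * ℕ→ℚ (n C 3) ≤ ℕ→ℚ ∣ H ∣ₑ)) ×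
      ((H : Graph3 n) → Free 𝓕 H → ℕ→ℚ ∣ H ∣ₑ ≤ q₂ * ℕ→ℚ (n C 3)))

-- α is a non-jump: every interval (α, α + c), c > 0, contains the Turán
-- density of some non-empty family of 3-graphs.
-- (c ranges over positive rationals, equivalent to positive reals.)
NonJump : ℚ → Set₁
NonJump α = (c : ℚ) → 0ℚ < c →
  Σ[ 𝓕 ∈ Family ] NonEmpty 𝓕 × TuranDensityIn 𝓕 α (α + c)

{-# OPTIONS --safe #-}
module Submission where

-- The pattern has a vertex B and, for every p in ℤ/n, a cell of four vertices y¹, y², z¹, z².  Its edges are
-- B v w with v, w in different cells; y z v with y, z in one cell and v in another; and y¹ y² y′, z¹ z² z′ with
-- y′, z′ in the next cell.  The family consists of the 3-graphs without a homomorphism to the pattern, so its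
-- Turán density is six times the maximum of the edge polynomial e of the pattern over weights with sum 1.
--
-- Let b be the weight of B, u_p the weights of the cells, u′_p = u_(p+1), a = Σ u and w = (2a - 4b)/3.  For y = z
-- and y¹ = y², z¹ = z² in every cell,
--   4/9 (a + b)³ - 6 e = 3/8 (Σ 3u(u - w)² + Σ (u³ - u²u′) - w³/2),
-- and other weights only lose as long as u ≤ 3a/4.  Constant u = w leaves - w³/2, hence a density above 4/9.
-- Conversely, since Σ u ≥ 3w/2, some u is close to w unless the first sum exceeds w³/2 anyway, and some u is at
-- most a/n; the walk around the cycle between these two places costs at least w³/2 - O(1/n) in the two sums, so
-- the excess over 4/9 tends to 0 with 1/n.

open import Defs
open import Data.Bool using (Bool; true; false; _∧_; not; T)
open import Data.Bool.Properties using (T?; T-∧)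
open import Data.Fin as Fin using (Fin)
import Data.Fin.Properties as Finₚ
open import Data.Integer using (ℤ; +_; -[1+_]; 0ℤ; 1ℤ; _+_; _*_; _-_; -_; _≤_; _<_; _⊓_; Positive; nonNegative; +≤+; +<+)
open import Data.Integer.Properties
open import Data.Integer.Tactic.RingSolver using (solve-∀)
open import Data.List using (List; []; _∷_; _++_; length; map; replicate; tabulate; allFin; cartesianProduct; filter; lookup)
open import Data.List.Membership.Propositional using (_∈_; lose; find)
open import Data.List.Membership.Propositional.Properties using (∈-cartesianProduct⁺; ∈-allFin; ∈-filter⁺; ∈-filter⁻; ∈-lookup)
open import Data.List.Properties using (length-map; length-tabulate; length-++; length-replicate)
open import Data.List.Relation.Unary.All as All using (All; []; _∷_)
open import Data.List.Relation.Unary.All.Properties using (all-filter)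
open import Data.List.Relation.Unary.AllPairs using (_∷_)
open import Data.List.Relation.Unary.Any as Any using (Any; any?)
open import Data.List.Relation.Unary.Any.Properties using (lookup-index)
open import Data.List.Relation.Unary.Unique.Propositional using (Unique)
import Data.List.Relation.Unary.Unique.Propositional.Properties as Unique
open import Data.Nat as ℕ using (ℕ; zero; suc)
open import Data.Nat.Coprimality using (Coprime)
open import Data.Nat.DivMod using (_%_; m<n⇒m%n≡m; m%n<n; [m+n]%n≡m%n; n%n≡0; m≡m%n+[m/n]*n; m/n*n≤m; /-monoˡ-≤; m*n/n≡m)
import Data.Nat.Properties as ℕₚ
open import Data.Product using (_×_; _,_; proj₁; proj₂; ∃-syntax)
open import Data.Rational as ℚ using (ℚ; _/_; mkℚ; toℚᵘ)
import Data.Rational.Properties as ℚₚ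
open import Data.Rational.Unnormalised as ℚᵘ using (mkℚᵘ)
import Data.Rational.Unnormalised.Properties as ℚᵘₚ
open import Data.Sum using (_⊎_; inj₁; inj₂)
open import Data.Unit using (tt)
open import Function using (_∘_; id; Equivalence)
open import Relation.Binary.Definitions using (tri<; tri≈; tri>)
open import Relation.Binary.PropositionalEquality
open import Relation.Nullary using (¬_; Dec; does; yes; no; contradiction; _×-dec_; _⊎-dec_)
open import Relation.Nullary.Decidable using (dec-true; dec-false; decidable-stable)

-- Nonnegative integers

-- If `B v w` were an edge for all `v`, `w` in the cells, these edges alone would give density 4/9,
-- attained at `a = 2b`. Excluding pairs inside a cell costs `b u²/2`; the edges `y z v` return
-- `u²(a - u)/4`, the same amount to second order in `u` exactly when `a = 2b`. So only terms cubic
-- in `u` and in the defect `w` decide. Without the cyclic edges a single cell near `w` would cost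
-- about `w³`, more than the `w³/2` to be gained; with them `u³` becomes `u³ - u²u′`, which sums to
-- 0 when all cells are equal.
--
-- The walk may fall or rise in one jump or in many small steps. Both kinds are covered by
-- potentials that bound every single step and telescope. Neither direction suffices alone: in the
-- scale of `step`, with `w = 8r`, the gain is `768r³`, while the potentials yield at most `480r³`
-- for the way down and `343r³` for the way up.

Nonneg : ℤ → Set
Nonneg x = 0ℤ ≤ x

nn : ∀ n → Nonneg (+ n)
nn n = +≤+ ℕ.z≤n

infixl 6 _⊕_
infixl 7 _⊗_

_⊕_ : ∀ {x y} → Nonneg x → Nonneg y → Nonneg (x + y)
p ⊕ q = +-mono-≤ p q

_⊗_ : ∀ {x y} → Nonneg x → Nonneg y → Nonneg (x * y)
_⊗_ {+ m} {+ n} p q = subst Nonneg (pos-* m n) (nn (m ℕ.* n))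

sq : ∀ x → Nonneg (x * x)
sq (+ n) = nn n ⊗ nn n
sq -[1+ n ] = nn _

gap : ∀ {x y} → x ≤ y → Nonneg (y - x)
gap = i≤j⇒0≤j-i

ungap : ∀ {x y} → Nonneg (y - x) → x ≤ y
ungap = 0≤i-j⇒j≤i

≤-by : ∀ {x y} z → y - x ≡ z → Nonneg z → x ≤ y
≤-by z eq p = ungap (subst Nonneg (sym eq) p)

≤-by-scaled : ∀ k {x y} z → (y - x) * + suc k ≡ z → Nonneg z → x ≤ y
≤-by-scaled k {x} {y} z eq p = ungap (*-cancelʳ-≤-pos 0ℤ (y - x) (+ suc k) (subst (0ℤ ≤_) (sym eq) p))

cube : ℤ → ℤ
cube x = x * x * x

-- The energy of one step of the cycle

-- Here w = 8 r, and step r u v is 3 (2u(u - w)² + u³ - u²v) up to the difference u³ - v³, which telescopes.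
step : ℤ → ℤ → ℤ → ℤ
step r u v = u * ((u - r * + 8) * (u - r * + 8)) * + 6 + (u * + 2 + v) * ((u - v) * (u - v))

step-nonneg : ∀ {r u v} → Nonneg u → Nonneg v → Nonneg (step r u v)
step-nonneg {r} {u} {v} pu pv =
  pu ⊗ sq (u - r * + 8) ⊗ nn 6 ⊕ (pu ⊗ nn 2 ⊕ pv) ⊗ sq (u - v)

-- `step` exceeds `v³ - u³` by `3u(2(u - 8r)² + u² - uv)`. For `v ≤ 7r` the bracket is at least
-- `3u² - 39ru + 128r²`, with discriminant `-15r²`. Hence the cap at `7r`: at `8r` the discriminant
-- would be positive.
step-ascending : ∀ {r u v} → Nonneg r → Nonneg u → Nonneg v →
  cube (v ⊓ (r * + 7)) - cube (u ⊓ (r * + 7)) ≤ step r u v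
step-ascending {r} {u} {v} pr pu pv with ≤-total u (r * + 7) | ≤-total v (r * + 7)
... | inj₁ u≤ | inj₁ v≤ rewrite i≤j⇒i⊓j≡i u≤ | i≤j⇒i⊓j≡i v≤ =
  ≤-by-scaled 11 _ (eq u v r)
    (pu ⊗ (sq (u * + 6 - r * + 39) ⊕ sq r ⊗ nn 15) ⊗ nn 3 ⊕ sq u ⊗ gap v≤ ⊗ nn 36)
  where
  eq : ∀ u v r →
    (u * ((u - r * + 8) * (u - r * + 8)) * + 6 + (u * + 2 + v) * ((u - v) * (u - v))
            - (v * v * v - u * u * u)) * + 12
    ≡ u * ((u * + 6 - r * + 39) * (u * + 6 - r * + 39) + (r * r) * + 15) * + 3 + (u * u) * (r * + 7 - v) * + 36
  eq = solve-∀
-- For `v ≥ u` the value of `step` increases with `v`. The first summand is the case `v = 7r`, the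
-- second the increase beyond it.
... | inj₁ u≤ | inj₂ v≥ rewrite i≤j⇒i⊓j≡i u≤ | i≥j⇒i⊓j≡j v≥ =
  ≤-by-scaled 11 _ (eq u v r)
    (pu ⊗ (sq (u * + 6 - r * + 39) ⊕ sq r ⊗ nn 15) ⊗ nn 3
     ⊕ gap v≥ ⊗ (gap u≤ ⊗ (pr ⊗ nn 7 ⊕ pu) ⊗ nn 3 ⊕ pr ⊗ gap v≥ ⊗ nn 21 ⊕ sq (v - r * + 7)) ⊗ nn 12)
  where
  eq : ∀ u v r →
    (u * ((u - r * + 8) * (u - r * + 8)) * + 6 + (u * + 2 + v) * ((u - v) * (u - v))
            - ((r * + 7) * (r * + 7) * (r * + 7) - u * u * u)) * + 12
    ≡ u * ((u * + 6 - r * + 39) * (u * + 6 - r * + 39) + (r * r) * + 15) * + 3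
      + (v - r * + 7) * ((r * + 7 - u) * (r * + 7 + u) * + 3 + r * (v - r * + 7) * + 21
                                + (v - r * + 7) * (v - r * + 7)) * + 12
  eq = solve-∀
... | inj₂ u≥ | inj₁ v≤ rewrite i≥j⇒i⊓j≡j u≥ | i≤j⇒i⊓j≡i v≤ =
  ≤-by _ (eq v r (step r u v))
    (step-nonneg {r} pu pv ⊕ gap v≤ ⊗ (sq r ⊗ nn 49 ⊕ pr ⊗ pv ⊗ nn 7 ⊕ sq v))
  where
  eq : ∀ v r s → s - (v * v * v - (r * + 7) * (r * + 7) * (r * + 7))
    ≡ s + (r * + 7 - v) * ((r * r) * + 49 + r * v * + 7 + v * v)
  eq = solve-∀
... | inj₂ u≥ | inj₂ v≥ rewrite i≥j⇒i⊓j≡j u≥ | i≥j⇒i⊓j≡j v≥ =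
  ≤-by _ (eq r (step r u v)) (step-nonneg {r} pu pv)
  where
  eq : ∀ r s → s - ((r * + 7) * (r * + 7) * (r * + 7) - (r * + 7) * (r * + 7) * (r * + 7)) ≡ s
  eq = solve-∀

ramp : ℤ → ℤ → ℤ
ramp r x = (r * r) * (x ⊓ (r * + 6)) * + 80

-- A step from `u ≤ 6r` pays at least `24r²u` however short it is, and a long one pays for
-- `(u - v)²` as well, so a linear potential works. Near `8r` short steps are almost free, hence the
-- cap at `6r`. The jump from `6r` to 0 costs `576r³`, that is slope `96r²`; the slope `80r²` leaves
-- room for the other steps.
step-descending : ∀ {r u v} → Nonneg r → Nonneg u → Nonneg v →
  ramp r u - ramp r v ≤ step r u v
step-descending {r} {u} {v} pr pu pv with ≤-total u (r * + 6) | ≤-total v (r * + 6)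
... | inj₂ u≥ | inj₂ v≥ rewrite i≥j⇒i⊓j≡j u≥ | i≥j⇒i⊓j≡j v≥ =
  ≤-by _ (eq r (step r u v)) (step-nonneg {r} pu pv)
  where
  eq : ∀ r s → s - ((r * r) * (r * + 6) * + 80 - (r * r) * (r * + 6) * + 80) ≡ s
  eq = solve-∀
... | inj₁ u≤ | inj₂ v≥ rewrite i≤j⇒i⊓j≡i u≤ | i≥j⇒i⊓j≡j v≥ =
  ≤-by _ (eq u r (step r u v)) (step-nonneg {r} pu pv ⊕ sq r ⊗ gap u≤ ⊗ nn 80)
  where
  eq : ∀ u r s → s - ((r * r) * u * + 80 - (r * r) * (r * + 6) * + 80) ≡ s + (r * r) * (r * + 6 - u) * + 80
  eq = solve-∀
-- With `p = u - 6r` and `q = 6r - v`, the first square absorbs all terms linear in `p`. What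
-- remains is `p²(8p + 3q)` and a polynomial in `r` and `q`.
... | inj₂ u≥ | inj₁ v≤ rewrite i≥j⇒i⊓j≡j u≥ | i≤j⇒i⊓j≡i v≤ =
  ≤-by-scaled 119 _ (eq u v r)
    (pr ⊗ sq ((u - r * + 6) * + 60 - r * + 120 + (r * + 6 - v) * + 36)
     ⊕ (pr ⊗ (sq (r * + 6 - v) ⊕ sq (r * + 6 - v - r * + 4) ⊗ nn 5 ⊕ sq r ⊗ nn 40)
                ⊕ sq (r * + 6 - v) ⊗ pv ⊗ nn 5) ⊗ nn 24
     ⊕ sq (u - r * + 6) ⊗ (gap u≥ ⊗ nn 8 ⊕ gap v≤ ⊗ nn 3) ⊗ nn 120)
  where
  eq : ∀ u v r →
    (u * ((u - r * + 8) * (u - r * + 8)) * + 6 + (u * + 2 + v) * ((u - v) * (u - v))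
            - ((r * r) * (r * + 6) * + 80 - (r * r) * v * + 80)) * + 120
    ≡ r * (((u - r * + 6) * + 60 - r * + 120 + (r * + 6 - v) * + 36) * ((u - r * + 6) * + 60 - r * + 120 + (r * + 6 - v) * + 36))
      + (r * ((r * + 6 - v) * (r * + 6 - v) + ((r * + 6 - v - r * + 4) * (r * + 6 - v - r * + 4)) * + 5 + (r * r) * + 40)
                + ((r * + 6 - v) * (r * + 6 - v)) * v * + 5) * + 24
      + ((u - r * + 6) * (u - r * + 6)) * ((u - r * + 6) * + 8 + (r * + 6 - v) * + 3) * + 120
  eq = solve-∀
... | inj₁ u≤ | inj₁ v≤ rewrite i≤j⇒i⊓j≡i u≤ | i≤j⇒i⊓j≡i v≤ with ≤-total u v
...   | inj₁ u≤v =
  ≤-by _ (eq u v r (step r u v)) (step-nonneg {r} pu pv ⊕ sq r ⊗ gap u≤v ⊗ nn 80)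
  where
  eq : ∀ u v r s → s - ((r * r) * u * + 80 - (r * r) * v * + 80) ≡ s + (r * r) * (v - u) * + 80
  eq = solve-∀
-- Substituting `r = (u + (6r - u))/6` turns `80r²` into `20/9` of a square, hence the factor 9. In
-- `v`, `u - v` and `6r - u` the only negative coefficient is that of `v²(u - v)`, which the square
-- of `v - (u - v)` takes up.
...   | inj₂ v≤u =
  ≤-by-scaled 8 _ (eq u v r)
    (pv ⊗ (sq v ⊗ nn 5 ⊕ sq (v - (u - v)) ⊕ sq (u - v) ⊗ nn 4) ⊕ sq (u - v) ⊗ gap v≤u ⊗ nn 4
     ⊕ gap u≤ ⊗ (pv ⊗ gap u≤ ⊗ nn 96 ⊕ gap v≤u ⊗ gap u≤ ⊗ nn 76 ⊕ sq v ⊗ nn 48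
                 ⊕ sq (u - v) ⊗ nn 8 ⊕ pv ⊗ gap v≤u ⊗ nn 56))
  where
  eq : ∀ u v r →
    (u * ((u - r * + 8) * (u - r * + 8)) * + 6 + (u * + 2 + v) * ((u - v) * (u - v))
            - ((r * r) * u * + 80 - (r * r) * v * + 80)) * + 9
    ≡ v * ((v * v) * + 5 + (v - (u - v)) * (v - (u - v)) + ((u - v) * (u - v)) * + 4) + ((u - v) * (u - v)) * (u - v) * + 4
      + (r * + 6 - u) * (v * (r * + 6 - u) * + 96 + (u - v) * (r * + 6 - u) * + 76 + (v * v) * + 48
                         + ((u - v) * (u - v)) * + 8 + v * (u - v) * + 56)
  eq = solve-∀

-- A lower bound for the cost of a descent from x to 0 and the ascent back to x.
barrier : ℤ → ℤ → ℤ
barrier r x = ramp r x + cube (x ⊓ (r * + 7))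

6r≤7r : ∀ {r} → Nonneg r → r * + 6 ≤ r * + 7
6r≤7r {r} pr = ≤-by r (eq r) pr
  where
  eq : ∀ r → r * + 7 - r * + 6 ≡ r
  eq = solve-∀

-- From `7r` on, the barrier is `823r³`; a lower `x` is compensated by its distance from `8r`. The
-- coefficient `36r` is chosen to become `3A` under `12r ≤ A`. In the upper bound `129 = 80 + 7²`,
-- and being linear in `x` it can be summed over all cells.
barrier-bounds : ∀ {r x} → Nonneg r → Nonneg x →
  (cube r * + 768 ≤ barrier r x + r * ((x - r * + 8) * (x - r * + 8)) * + 36) × (barrier r x ≤ r * r * + 129 * x)
barrier-bounds {r} {x} pr px with ≤-total x (r * + 6)
... | inj₁ x≤6 rewrite i≤j⇒i⊓j≡i x≤6 | i≤j⇒i⊓j≡i (≤-trans x≤6 (6r≤7r pr)) =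
  ≤-by _ (eq₁ x r) (pr ⊗ (sq (r * + 6 - x - r) ⊗ nn 22 ⊕ sq r ⊗ nn 50 ⊕ sq (r * + 6 - x) ⊗ nn 26) ⊕ sq (r * + 6 - x) ⊗ px) ,
  ≤-by _ (eq₂ x r) (px ⊗ gap (≤-trans x≤6 (6r≤7r pr)) ⊗ (pr ⊗ nn 7 ⊕ px))
  where
  eq₁ : ∀ x r → (r * r) * x * + 80 + x * x * x + r * ((x - r * + 8) * (x - r * + 8)) * + 36 - (r * r * r) * + 768
    ≡ r * (((r * + 6 - x - r) * (r * + 6 - x - r)) * + 22 + (r * r) * + 50 + ((r * + 6 - x) * (r * + 6 - x)) * + 26)
      + (r * + 6 - x) * (r * + 6 - x) * x
  eq₁ = solve-∀
  eq₂ : ∀ x r → r * r * + 129 * x - ((r * r) * x * + 80 + x * x * x) ≡ x * (r * + 7 - x) * (r * + 7 + x)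
  eq₂ = solve-∀
... | inj₂ x≥6 with ≤-total x (r * + 7)
...   | inj₁ x≤7 rewrite i≥j⇒i⊓j≡j x≥6 | i≤j⇒i⊓j≡i x≤7 =
  ≤-by _ (eq₁ x r) (pr ⊗ (sq (x - r * + 6 - r) ⊗ nn 18 ⊕ sq r ⊗ nn 54 ⊕ sq (x - r * + 6) ⊗ nn 36)
                     ⊕ sq (x - r * + 6) ⊗ gap x≥6) ,
  ≤-by _ (eq₂ x r) (sq r ⊗ gap x≥6 ⊗ nn 80 ⊕ px ⊗ gap x≤7 ⊗ (pr ⊗ nn 7 ⊕ px))
  where
  eq₁ : ∀ x r → (r * r) * (r * + 6) * + 80 + x * x * x + r * ((x - r * + 8) * (x - r * + 8)) * + 36 - (r * r * r) * + 768
    ≡ r * (((x - r * + 6 - r) * (x - r * + 6 - r)) * + 18 + (r * r) * + 54 + ((x - r * + 6) * (x - r * + 6)) * + 36)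
      + (x - r * + 6) * (x - r * + 6) * (x - r * + 6)
  eq₁ = solve-∀
  eq₂ : ∀ x r → r * r * + 129 * x - ((r * r) * (r * + 6) * + 80 + x * x * x)
    ≡ (r * r) * (x - r * + 6) * + 80 + x * (r * + 7 - x) * (r * + 7 + x)
  eq₂ = solve-∀
...   | inj₂ x≥7 rewrite i≥j⇒i⊓j≡j x≥6 | i≥j⇒i⊓j≡j x≥7 =
  ≤-by _ (eq₁ x r) ((pr ⊗ sq r) ⊗ nn 55 ⊕ pr ⊗ sq (x - r * + 8) ⊗ nn 36) ,
  ≤-by _ (eq₂ x r) (sq r ⊗ gap x≥7 ⊗ nn 129 ⊕ (pr ⊗ sq r) ⊗ nn 80)
  where
  eq₁ : ∀ x r → (r * r) * (r * + 6) * + 80 + (r * + 7) * (r * + 7) * (r * + 7)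
      + r * ((x - r * + 8) * (x - r * + 8)) * + 36 - (r * r * r) * + 768
    ≡ (r * (r * r)) * + 55 + r * ((x - r * + 8) * (x - r * + 8)) * + 36
  eq₁ = solve-∀
  eq₂ : ∀ x r → r * r * + 129 * x - ((r * r) * (r * + 6) * + 80 + (r * + 7) * (r * + 7) * (r * + 7))
    ≡ (r * r) * (x - r * + 7) * + 129 + (r * (r * r)) * + 80
  eq₂ = solve-∀

-- Finite sums of integers

∑ : ℕ → (ℕ → ℤ) → ℤ
∑ zero    f = 0ℤ
∑ (suc n) f = ∑ n f + f n

∑-cong : ∀ n {f g} → (∀ i → f i ≡ g i) → ∑ n f ≡ ∑ n g
∑-cong zero    eq = refl
∑-cong (suc n) eq = cong₂ _+_ (∑-cong n eq) (eq n)

∑-nonneg : ∀ n {f} → (∀ i → Nonneg (f i)) → Nonneg (∑ n f)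
∑-nonneg zero    p = nn 0
∑-nonneg (suc n) p = ∑-nonneg n p ⊕ p n

∑-mono : ∀ n {f g} → (∀ i → f i ≤ g i) → ∑ n f ≤ ∑ n g
∑-mono zero    p = ≤-refl
∑-mono (suc n) p = +-mono-≤ (∑-mono n p) (p n)

∑-+ : ∀ n f g → ∑ n (λ i → f i + g i) ≡ ∑ n f + ∑ n g
∑-+ zero    f g = refl
∑-+ (suc n) f g rewrite ∑-+ n f g = eq (∑ n f) (∑ n g) (f n) (g n)
  where
  eq : ∀ a b c d → a + b + (c + d) ≡ a + c + (b + d)
  eq = solve-∀

∑-* : ∀ n c f → ∑ n (λ i → c * f i) ≡ c * ∑ n f
∑-* zero    c f = sym (*-zeroʳ c)
∑-* (suc n) c f rewrite ∑-* n c f = sym (*-distribˡ-+ c (∑ n f) (f n))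

∑-const : ∀ n c → ∑ n (λ _ → c) ≡ + n * c
∑-const zero    c = sym (*-zeroˡ c)
∑-const (suc n) c rewrite ∑-const n c = eq (+ n) c
  where
  eq : ∀ n c → n * c + c ≡ (1ℤ + n) * c
  eq = solve-∀

∑-shift : ∀ n f → ∑ n (λ i → f (suc i)) + f 0 ≡ ∑ n f + f n
∑-shift zero    f = refl
∑-shift (suc n) f = trans (eq (∑ n (λ i → f (suc i))) (f (suc n)) (f 0)) (cong (_+ f (suc n)) (∑-shift n f))
  where
  eq : ∀ a b c → a + b + c ≡ a + c + b
  eq = solve-∀

∑-cyclic : ∀ n f → f n ≡ f 0 → ∑ n (λ i → f (suc i)) ≡ ∑ n f
∑-cyclic n f p = +-cancelʳ-≡ (f 0) _ _ (trans (∑-shift n f) (cong (λ z → ∑ n f + z) p))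
  where
  +-cancelʳ-≡ : ∀ k x y → x + k ≡ y + k → x ≡ y
  +-cancelʳ-≡ k x y eq = trans (sym (lem x k)) (trans (cong (_- k) eq) (lem y k))
    where
    lem : ∀ x k → x + k - k ≡ x
    lem = solve-∀

telescope : ∀ (φ e : ℕ → ℤ) → (∀ i → φ i - φ (suc i) ≤ e i) →
  ∀ k {j} → k ℕ.≤′ j → φ k - φ j ≤ ∑ j e - ∑ k e
telescope φ e p k ℕ.≤′-refl = ≤-reflexive (trans (+-inverseʳ (φ k)) (sym (+-inverseʳ (∑ k e))))
telescope φ e p k (ℕ.≤′-step {j} k≤j) =
  subst₂ _≤_ (eq₁ (φ k) (φ j) (φ (suc j))) (eq₂ (∑ j e) (∑ k e) (e j)) (+-mono-≤ (telescope φ e p k k≤j) (p j))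
  where
  eq₁ : ∀ a b c → a - b + (b - c) ≡ a - c
  eq₁ = solve-∀
  eq₂ : ∀ a b c → a - b + c ≡ a + c - b
  eq₂ = solve-∀

-- Whatever the order of m and l, the cyclic walk ascends from l to m once and descends from m to l once.
round-trip : ∀ n (φ ψ e : ℕ → ℤ) → φ n ≡ φ 0 → ψ n ≡ ψ 0 →
  (∀ i → φ i - φ (suc i) ≤ e i) → (∀ i → ψ (suc i) - ψ i ≤ e i) →
  ∀ {m l} → m ℕ.≤ n → l ℕ.≤ n → (φ m + ψ m) - (φ l + ψ l) ≤ ∑ n e
round-trip n φ ψ e φn ψn p q {m} {l} m≤n l≤n = helper (ℕₚ.≤-total m l)
  where
  q′ : ∀ i → - ψ i - - ψ (suc i) ≤ e i
  q′ i = subst (_≤ e i) (eq (ψ i) (ψ (suc i))) (q i)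
    where
    eq : ∀ a b → b - a ≡ - a - - b
    eq = solve-∀
  down : ∀ {k j} → k ℕ.≤ j → φ k - φ j ≤ ∑ j e - ∑ k e
  down {k} k≤j = telescope φ e p k (ℕₚ.≤⇒≤′ k≤j)
  up : ∀ {k j} → k ℕ.≤ j → - ψ k - - ψ j ≤ ∑ j e - ∑ k e
  up {k} k≤j = telescope (λ i → - ψ i) e q′ k (ℕₚ.≤⇒≤′ k≤j)
  eqR : ∀ a b c → (c - b) + (b - a) + (a - 0ℤ) ≡ c
  eqR = solve-∀
  helper : _ → (φ m + ψ m) - (φ l + ψ l) ≤ ∑ n e
  -- The ascent from `l` to `m` passes the point where `n` is identified with 0, so it is split
  -- there. In the other case this happens to the descent.
  helper (inj₁ m≤l) = subst₂ _≤_
    (trans (cong (λ z → - ψ l - - z + (φ m - φ l) + (- ψ 0 - - ψ m)) ψn) (eqL (φ m) (ψ m) (φ l) (ψ l) (ψ 0)))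
    (eqR (∑ m e) (∑ l e) (∑ n e))
    (+-mono-≤ (+-mono-≤ (up l≤n) (down m≤l)) (up {0} ℕ.z≤n))
    where
    eqL : ∀ a b c d z → - d - - z + (a - c) + (- z - - b) ≡ a + b - (c + d)
    eqL = solve-∀
  helper (inj₂ l≤m) = subst₂ _≤_
    (trans (cong (λ z → φ m - z + (- ψ l - - ψ m) + (φ 0 - φ l)) φn) (eqL (φ m) (ψ m) (φ l) (ψ l) (φ 0)))
    (eqR (∑ l e) (∑ m e) (∑ n e))
    (+-mono-≤ (+-mono-≤ (down m≤n) (up l≤m)) (down {0} ℕ.z≤n))
    where
    eqL : ∀ a b c d z → a - z + (- d - - b) + (z - c) ≡ a + b - (c + d)
    eqL = solve-∀

∑-mono< : ∀ n {f g} → (∀ i → i ℕ.< n → f i ≤ g i) → ∑ n f ≤ ∑ n g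
∑-mono< zero    p = ≤-refl
∑-mono< (suc n) p = +-mono-≤ (∑-mono< n (λ i i<n → p i (ℕₚ.m<n⇒m<1+n i<n))) (p n ℕₚ.≤-refl)

-- Averaging the round trip over both of its ends

module Cycle (n : ℕ) (x : ℕ → ℤ) (x≥0 : ∀ i → Nonneg (x i)) (xn : x n ≡ x 0)
             (r : ℤ) (r≥0 : Nonneg r) where

  A E V : ℤ
  A = ∑ n x
  E = ∑ n (λ i → step r (x i) (x (suc i)))
  V = ∑ n (λ i → x i * ((x i - r * + 8) * (x i - r * + 8)))

  A≥0 : Nonneg A
  A≥0 = ∑-nonneg n x≥0
  E≥0 : Nonneg E
  E≥0 = ∑-nonneg n (λ i → step-nonneg {r} (x≥0 i) (x≥0 (suc i)))
  V≥0 : Nonneg V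
  V≥0 = ∑-nonneg n (λ i → x≥0 i ⊗ sq (x i - r * + 8))

  H : ℕ → ℤ
  H i = barrier r (x i)

  E-≥ : ∀ {m l} → m ℕ.< n → l ℕ.< n → H m - H l ≤ E
  E-≥ m<n l<n = round-trip n (λ i → ramp r (x i)) (λ i → cube (x i ⊓ (r * + 7))) _
    (cong (ramp r) xn) (cong (λ z → cube (z ⊓ (r * + 7))) xn)
    (λ i → step-descending r≥0 (x≥0 i) (x≥0 (suc i))) (λ i → step-ascending r≥0 (x≥0 i) (x≥0 (suc i)))
    (ℕₚ.<⇒≤ m<n) (ℕₚ.<⇒≤ l<n)

  K : ℤ
  K = r * r * + 129

  -- The round trip from `m` is summed over all low points `l`. Since `H l ≤ K x l`, the average
  -- does the work of a cell of size at most `A/n`, and no smallest cell has to be chosen.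
  nE-≥ : ∀ {m} → m ℕ.< n → + n * H m ≤ + n * E + K * A
  nE-≥ {m} m<n = subst₂ _≤_ (∑-const n (H m))
    (trans (∑-+ n (λ _ → E) (λ l → K * x l)) (cong₂ _+_ (∑-const n E) (∑-* n K x)))
    (∑-mono< n pt)
    where
    eq : ∀ a b → a - b + b ≡ a
    eq = solve-∀
    pt : ∀ l → l ℕ.< n → H m ≤ E + K * x l
    pt l l<n = subst (_≤ E + K * x l) (eq (H m) (H l))
      (+-mono-≤ (E-≥ m<n l<n) (proj₂ (barrier-bounds r≥0 (x≥0 l))))

  module _ (12r≤A : r * + 12 ≤ A) where

    H-≥ : ∀ m → cube r * + 768 ≤ H m + A * ((x m - r * + 8) * (x m - r * + 8)) * + 3
    H-≥ m = ≤-trans (proj₁ (barrier-bounds r≥0 (x≥0 m)))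
      (+-monoʳ-≤ (H m) (≤-by _ (eq r A ((x m - r * + 8) * (x m - r * + 8))) (gap 12r≤A ⊗ sq (x m - r * + 8) ⊗ nn 3)))
      where
      eq : ∀ r A q → A * q * + 3 - r * q * + 36 ≡ (A - r * + 12) * q * + 3
      eq = solve-∀

    v : ℕ → ℤ
    v m = x m * ((x m - r * + 8) * (x m - r * + 8))
    B D : ℤ
    B = + n * E + K * A
    D = + n * (cube r * + 768)

    -- The high points are averaged with weights `x m`: then the errors `(x m - 8r)²` of `H-≥` add
    -- up to exactly `V`. This replaces the search for a cell close to `8r`.
    weighted : A * D ≤ A * (+ n * (E + V * + 3) + K * A)
    weighted = subst₂ _≤_ (trans (∑-* n D x) (*-comm D A))
      (trans (∑-+ n (λ m → B * x m) (λ m → + n * (A * + 3) * v m))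
        (trans (cong₂ _+_ (∑-* n B x) (∑-* n (+ n * (A * + 3)) v)) (eq₂ A (+ n) E V K)))
      (∑-mono< n pt)
      where
      eq₂ : ∀ A n E V K → (n * E + K * A) * A + n * (A * + 3) * V ≡ A * (n * (E + V * + 3) + K * A)
      eq₂ = solve-∀
      pt : ∀ m → m ℕ.< n → D * x m ≤ B * x m + + n * (A * + 3) * v m
      pt m m<n = ≤-by _ (eq (x m) (+ n) (cube r * + 768) A (H m) B ((x m - r * + 8) * (x m - r * + 8)))
        (x≥0 m ⊗ (nn n ⊗ gap (H-≥ m) ⊕ gap (nE-≥ m<n)))
        where
        eq : ∀ x n c A H C q → C * x + n * (A * + 3) * (x * q) - n * c * x
          ≡ x * (n * (H + A * q * + 3 - c) + (C - n * H))
        eq = solve-∀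

    energy-bound : + n * (cube r * + 768) ≤ + n * (E + V * + 3) + K * A
    energy-bound = cancel A A≥0 refl
      where
      cancel : ∀ α → Nonneg α → A ≡ α → D ≤ + n * (E + V * + 3) + K * A
      cancel (+ suc k) _ A≡ = *-cancelˡ-≤-pos _ _ (+ suc k) (subst (λ α → α * D ≤ α * (+ n * (E + V * + 3) + K * A)) A≡ weighted)
      -- For `A = 0` the factor `A` cannot be cancelled, but then `12r ≤ A` forces `r = 0` and the
      -- left side vanishes.
      cancel (+ zero)  _ A≡ = subst (_≤ + n * (E + V * + 3) + K * A) (sym D≡0)
          (nn n ⊗ (E≥0 ⊕ V≥0 ⊗ nn 3) ⊕ sq r ⊗ nn 129 ⊗ A≥0)
        where
        r≡0 : r ≡ 0ℤ
        r≡0 = ≤-antisym (*-cancelʳ-≤-pos r 0ℤ (+ 12) (subst (r * + 12 ≤_) A≡ 12r≤A)) r≥0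
        D≡0 : D ≡ 0ℤ
        D≡0 = trans (cong (λ s → + n * (cube s * + 768)) r≡0) (*-zeroʳ (+ n))

∑-lin : ∀ n a b c f g h →
  ∑ n (λ i → f i * a + g i * b + h i * c) ≡ ∑ n f * a + ∑ n g * b + ∑ n h * c
∑-lin zero    a b c f g h = refl
∑-lin (suc n) a b c f g h rewrite ∑-lin n a b c f g h = eq (∑ n f) (∑ n g) (∑ n h) (f n) (g n) (h n) a b c
  where
  eq : ∀ F G H f g h a b c → F * a + G * b + H * c + (f * a + g * b + h * c) ≡ (F + f) * a + (G + g) * b + (H + h) * c
  eq = solve-∀

∑-triple : ∀ {n f} → 3 ℕ.≤ n → (∀ i → Nonneg (f i)) → f 0 + f 1 + f 2 ≤ ∑ n f
∑-triple {suc (suc (suc k))} (ℕ.s≤s (ℕ.s≤s (ℕ.s≤s ℕ.z≤n))) p = from k p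
  where
  from : ∀ k {f} → (∀ i → Nonneg (f i)) → f 0 + f 1 + f 2 ≤ ∑ (3 ℕ.+ k) f
  from zero    {f} p = ≤-reflexive (cong (λ z → z + f 1 + f 2) (sym (+-identityˡ (f 0))))
  from (suc k) {f} p = ≤-trans (from k p)
    (subst (_≤ ∑ (3 ℕ.+ k) f + f (3 ℕ.+ k)) (+-identityʳ _) (+-monoʳ-≤ (∑ (3 ℕ.+ k) f) (p (3 ℕ.+ k))))

mask : ℕ → (ℕ → ℤ) → ℕ → ℤ
mask m f i with i ℕ.≟ m
... | yes _ = 0ℤ
... | no  _ = f i

mask-map : ∀ m (g : ℤ → ℤ) → g 0ℤ ≡ 0ℤ → ∀ f i → mask m (λ j → g (f j)) i ≡ g (mask m f i)
mask-map m g g0 f i with i ℕ.≟ m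
... | yes _ = sym g0
... | no  _ = refl

mask-nonneg : ∀ m {f} → (∀ i → Nonneg (f i)) → ∀ i → Nonneg (mask m f i)
mask-nonneg m p i with i ℕ.≟ m
... | yes _ = nn 0
... | no  _ = p i

∑-mask-≥ : ∀ n m f → n ℕ.≤ m → ∑ n f ≡ ∑ n (mask m f)
∑-mask-≥ zero    m f _ = refl
∑-mask-≥ (suc n) m f n<m with n ℕ.≟ m
... | yes refl = contradiction n<m (ℕₚ.<-irrefl refl)
... | no  _    = cong (_+ f n) (∑-mask-≥ n m f (ℕₚ.<⇒≤ n<m))

∑-mask : ∀ n m f → m ℕ.< n → ∑ n f ≡ f m + ∑ n (mask m f)
∑-mask (suc n) m f m<1+n with n ℕ.≟ m
... | yes refl = trans (cong (_+ f n) (∑-mask-≥ n n f ℕₚ.≤-refl)) (eq (∑ n (mask n f)) (f n))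
  where
  eq : ∀ a b → a + b ≡ b + (a + 0ℤ)
  eq = solve-∀
... | no n≢m = trans (cong (_+ f n) (∑-mask n m f (ℕₚ.≤∧≢⇒< (ℕ.s≤s⁻¹ m<1+n) (λ e → n≢m (sym e))))) (+-assoc (f m) (∑ n (mask m f)) (f n))

∑-sq≤ : ∀ n {f} → (∀ i → Nonneg (f i)) → ∑ n (λ i → f i * f i) ≤ ∑ n f * ∑ n f
∑-sq≤ zero    p = ≤-refl
∑-sq≤ (suc n) {f} p = ≤-by _ (eq (∑ n (λ i → f i * f i)) (∑ n f) (f n))
  (gap (∑-sq≤ n p) ⊕ ∑-nonneg n p ⊗ p n ⊗ nn 2)
  where
  eq : ∀ q s x → (s + x) * (s + x) - (q + x * x) ≡ s * s - q + s * x * + 2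
  eq = solve-∀

all-or-some : ∀ n (f : ℕ → ℤ) c → (∀ i → i ℕ.< n → f i ≤ c) ⊎ (∃[ m ] m ℕ.< n × c ≤ f m)
all-or-some zero    f c = inj₁ (λ _ ())
all-or-some (suc n) f c with ≤-total (f n) c | all-or-some n f c
... | inj₂ c≤fn | _ = inj₂ (n , ℕₚ.≤-refl , c≤fn)
... | inj₁ _    | inj₂ (m , m<n , c≤fm) = inj₂ (m , ℕₚ.m<n⇒m<1+n m<n , c≤fm)
... | inj₁ fn≤c | inj₁ all = inj₁ below
  where
  below : ∀ i → i ℕ.< suc n → f i ≤ c
  below i i<1+n with ℕₚ.m≤n⇒m<n∨m≡n (ℕ.s≤s⁻¹ i<1+n)
  ... | inj₁ i<n  = all i i<n
  ... | inj₂ refl = fn≤c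

-- The upper bound for the edge polynomial

module EdgeBound (n : ℕ) (3≤n : 3 ℕ.≤ n) (b : ℤ) (b≥0 : Nonneg b)
  (y₁ y₂ z₁ z₂ : ℕ → ℤ)
  (y₁≥0 : ∀ i → Nonneg (y₁ i)) (y₂≥0 : ∀ i → Nonneg (y₂ i))
  (z₁≥0 : ∀ i → Nonneg (z₁ i)) (z₂≥0 : ∀ i → Nonneg (z₂ i))
  (y₁-per : ∀ i → y₁ (i ℕ.+ n) ≡ y₁ i) (y₂-per : ∀ i → y₂ (i ℕ.+ n) ≡ y₂ i)
  (z₁-per : ∀ i → z₁ (i ℕ.+ n) ≡ z₁ i) (z₂-per : ∀ i → z₂ (i ℕ.+ n) ≡ z₂ i) where

  y z u d : ℕ → ℤ
  y i = y₁ i + y₂ i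
  z i = z₁ i + z₂ i
  u i = y i + z i
  d i = y i - z i

  a U C S : ℤ
  a = ∑ n u
  U = ∑ n (λ i → u i * u i)
  C = ∑ n (λ i → u i * u i * u i)
  S = ∑ n (λ i → u i * u i * u (suc i))

  pair gain : ℕ → ℤ
  pair i = y i * z i * (a - u i)
  gain i = y₁ i * y₂ i * y (suc i) + z₁ i * z₂ i * z (suc i)

  -- Doubling avoids the half in `b(a² - U)/2`, the contribution of the edges `B v w`.
  twice-edges : ℤ
  twice-edges = b * (a * a - U) + ∑ n (λ i → pair i + gain i) * + 2

  y≥0 : ∀ i → Nonneg (y i)
  y≥0 i = y₁≥0 i ⊕ y₂≥0 i
  z≥0 : ∀ i → Nonneg (z i)
  z≥0 i = z₁≥0 i ⊕ z₂≥0 i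
  u≥0 : ∀ i → Nonneg (u i)
  u≥0 i = y≥0 i ⊕ z≥0 i
  a≥0 : Nonneg a
  a≥0 = ∑-nonneg n u≥0

  y-per : ∀ i → y (i ℕ.+ n) ≡ y i
  y-per i = cong₂ _+_ (y₁-per i) (y₂-per i)
  z-per : ∀ i → z (i ℕ.+ n) ≡ z i
  z-per i = cong₂ _+_ (z₁-per i) (z₂-per i)
  u-per : ∀ i → u (i ℕ.+ n) ≡ u i
  u-per i = cong₂ _+_ (y-per i) (z-per i)
  d-per : ∀ i → d (i ℕ.+ n) ≡ d i
  d-per i = cong₂ _-_ (y-per i) (z-per i)

  rotate : ∀ i → ∑ n (λ j → u (i ℕ.+ j)) ≡ a
  rotate zero    = refl
  rotate (suc i) = trans (∑-cong n (λ j → cong u (sym (ℕₚ.+-suc i j))))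
    (trans (∑-cyclic n (λ j → u (i ℕ.+ j)) (trans (u-per i) (cong u (sym (ℕₚ.+-identityʳ i))))) (rotate i))

  -- Because `n ≥ 3`, three consecutive cells are distinct; rotating the cycle moves them to the
  -- places 0, 1, 2.
  triple≤a : ∀ i → u i + u (suc i) + u (suc (suc i)) ≤ a
  triple≤a i = subst₂ _≤_
    (cong₂ _+_ (cong₂ _+_ (cong u (ℕₚ.+-identityʳ i)) (cong u (ℕₚ.+-comm i 1))) (cong u (ℕₚ.+-comm i 2)))
    (rotate i) (∑-triple 3≤n (λ j → u≥0 (i ℕ.+ j)))

  excess : ℕ → ℤ
  excess i = (u i * + 2 + u (suc i)) * ((u i - u (suc i)) * (u i - u (suc i)))

  ∑-excess : ∑ n excess ≡ C * + 3 - S * + 3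
  ∑-excess = trans (∑-cong n (λ i → eq (u i) (u (suc i))))
      (trans (∑-lin n (+ 2) (+ 1) (- (+ 3)) (λ i → u i * u i * u i) (λ i → u (suc i) * u (suc i) * u (suc i)) (λ i → u i * u i * u (suc i)))
        (trans (cong (λ c → C * + 2 + c * + 1 + S * - (+ 3)) (∑-cyclic n (λ i → u i * u i * u i) (cong (λ v → v * v * v) (u-per 0)))) (eq′ C S)))
    where
    eq : ∀ u v → (u * + 2 + v) * ((u - v) * (u - v)) ≡ u * u * u * + 2 + v * v * v * + 1 + u * u * v * - (+ 3)
    eq = solve-∀
    eq′ : ∀ C S → C * + 2 + C * + 1 + S * - (+ 3) ≡ C * + 3 - S * + 3
    eq′ = solve-∀

  -- Weights are scaled by 12, so that 8 r = 12 w.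
  r N : ℤ
  r = a - b * + 2
  N = a + b

  N≥0 : Nonneg N
  N≥0 = a≥0 ⊕ b≥0

  -- With 12 uᵢ in the place of xᵢ this is a third of E + 3 V.
  energy : ℤ
  energy = (C * + 144 - U * (r * + 192) + a * (r * r * + 64)) * + 36 + (C - S) * + 1728

  x : ℕ → ℤ
  x i = u i * + 12

  ∑-step : ∑ n (λ i → step r (x i) (x (suc i))) + ∑ n (λ i → x i * ((x i - r * + 8) * (x i - r * + 8))) * + 3 ≡ energy * + 3
  ∑-step = trans (cong₂ (λ e v → e + v * + 3) E≡ V≡) (eq C U S a r)
    where
    W : ℕ → ℤ
    W i = x i * ((x i - r * + 8) * (x i - r * + 8))
    eqV : ∀ u r → u * + 12 * ((u * + 12 - r * + 8) * (u * + 12 - r * + 8))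
      ≡ u * u * u * + 1728 + u * u * - (r * + 2304) + u * (r * r * + 768)
    eqV = solve-∀
    V≡ : ∑ n W ≡ C * + 1728 + U * - (r * + 2304) + a * (r * r * + 768)
    V≡ = trans (∑-cong n (λ i → eqV (u i) r))
      (∑-lin n (+ 1728) (- (r * + 2304)) (r * r * + 768) (λ i → u i * u i * u i) (λ i → u i * u i) u)
    eqE : ∀ u v w → w * + 6 + (u * + 12 * + 2 + v * + 12) * ((u * + 12 - v * + 12) * (u * + 12 - v * + 12))
      ≡ w * + 6 + (u * + 2 + v) * ((u - v) * (u - v)) * + 1728 + w * 0ℤ
    eqE = solve-∀
    E≡ : ∑ n (λ i → step r (x i) (x (suc i)))
      ≡ (C * + 1728 + U * - (r * + 2304) + a * (r * r * + 768)) * + 6 + (C * + 3 - S * + 3) * + 1728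
        + (C * + 1728 + U * - (r * + 2304) + a * (r * r * + 768)) * 0ℤ
    E≡ = trans (∑-cong n (λ i → eqE (u i) (u (suc i)) (W i)))
      (trans (∑-lin n (+ 6) (+ 1728) 0ℤ W excess W) (cong₂ (λ v e → v * + 6 + e * + 1728 + v * 0ℤ) V≡ ∑-excess))
    eq : ∀ C U S a r → let V = C * + 1728 + U * - (r * + 2304) + a * (r * r * + 768) in
      V * + 6 + (C * + 3 - S * + 3) * + 1728 + V * 0ℤ + V * + 3
      ≡ ((C * + 144 - U * (r * + 192) + a * (r * r * + 64)) * + 36 + (C - S) * + 1728) * + 3
    eq = solve-∀

  x≥0 : ∀ i → Nonneg (x i)
  x≥0 i = u≥0 i ⊗ nn 12

  -- For `r ≥ 0` the error term of `energy-bound` is `129r² · 12a = 1548r²a`, and `0 ≤ r ≤ a ≤ N`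
  -- puts it below `1728N³`. For `r ≤ 0` the left side is not positive.
  energy-lower : + n * (cube r * + 768) ≤ + n * (energy * + 3) + cube N * + 1728
  energy-lower with ≤-total 0ℤ r
  ... | inj₁ r≥0 = ≤-trans (subst (λ e → + n * (cube r * + 768) ≤ + n * e + r * r * + 129 * ∑ n x) ∑-step
                              (Cycle.energy-bound n x x≥0 (cong (λ v → v * + 12) (u-per 0)) r r≥0 (subst (r * + 12 ≤_) (sym A≡) 12r≤A)))
                           (+-monoʳ-≤ (+ n * (energy * + 3)) (subst (_≤ cube N * + 1728) (sym (cong (λ α → r * r * + 129 * α) A≡)) (≤-by _ (eq₂ a b)
                              (b≥0 ⊗ (sq N ⊕ N≥0 ⊗ a≥0 ⊕ sq a) ⊗ nn 1728 ⊕ a≥0 ⊗ b≥0 ⊗ (a≥0 ⊕ r≥0) ⊗ nn 3456 ⊕ sq r ⊗ a≥0 ⊗ nn 180))))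
    where
    A≡ : ∑ n x ≡ a * + 12
    A≡ = trans (∑-cong n (λ i → *-comm (u i) (+ 12))) (trans (∑-* n (+ 12) u) (*-comm (+ 12) a))
    eq₁ : ∀ a b → a * + 12 - (a - b * + 2) * + 12 ≡ b * + 24
    eq₁ = solve-∀
    12r≤A : r * + 12 ≤ a * + 12
    12r≤A = ≤-by _ (eq₁ a b) (b≥0 ⊗ nn 24)
    eq₂ : ∀ a b → let r = a - b * + 2; N = a + b in
      N * N * N * + 1728 - r * r * + 129 * (a * + 12)
      ≡ b * (N * N + N * a + a * a) * + 1728 + a * b * (a + r) * + 3456 + r * r * a * + 180
    eq₂ = solve-∀
  ... | inj₂ r≤0 = ≤-by _ (eq (+ n) r (energy * + 3) (cube N))
      (nn n ⊗ energy≥0 ⊕ nn n ⊗ (sq r ⊗ neg-mono-≤ r≤0) ⊗ nn 768 ⊕ N≥0 ⊗ N≥0 ⊗ N≥0 ⊗ nn 1728)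
    where
    energy≥0 : Nonneg (energy * + 3)
    energy≥0 = subst Nonneg ∑-step
      (∑-nonneg n (λ i → step-nonneg {r} (x≥0 i) (x≥0 (suc i)))
       ⊕ ∑-nonneg n (λ i → x≥0 i ⊗ sq (x i - r * + 8)) ⊗ nn 3)
    eq : ∀ n r e N → n * e + N * + 1728 - n * (r * r * r * + 768) ≡ n * e + n * (r * r * - r) * + 768 + N * + 1728
    eq = solve-∀

  module Light (light : ∀ i → i ℕ.< n → u i * + 4 ≤ a * + 3) where

    light′ : ∀ i → i ℕ.< n → u (suc i) * + 4 ≤ a * + 3
    light′ i i<n with ℕₚ.m≤n⇒m<n∨m≡n i<n
    ... | inj₁ i+1<n = light (suc i) i+1<n
    ... | inj₂ eq    = subst (λ v → v * + 4 ≤ a * + 3) (sym (trans (cong u eq) (u-per 0))) (light 0 (ℕₚ.<-≤-trans ℕ.z<s 3≤n))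

    -- The loss caused by `y ≠ z`: it collects the terms with `d` after `4yz = u² - d²`,
    -- `4y₁y₂ ≤ y²`, `4z₁z₂ ≤ z²` and `4(y²y′ + z²z′) = (u² + d²)u′ + 2u d d′`.
    δ : ℕ → ℤ
    δ i = d i * d i * (a - u i) * + 4 - d i * d i * u (suc i) - u i * d i * d (suc i) * + 2

    P Q : ℕ → ℤ
    P i = d i * d i * (a * + 4 - u i * + 5 - u (suc i))
    Q i = - (u i * (d (suc i) * d (suc i)))

    -- By `2u d d′ ≤ u d² + u d′²` each `δ` is at least `P + Q`. After moving `P` by one cell, the
    -- square of `d (suc i)` has coefficient `4a - 5u - (both neighbours)`, which is `a` minus three
    -- consecutive cells plus `3a - 4u`. The threshold `3a/4` comes from here.
    δ≥0 : Nonneg (∑ n δ)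
    δ≥0 = ≤-trans (subst Nonneg shifted low) (∑-mono n pt)
      where
      low : Nonneg (∑ n (λ i → P (suc i) + Q i))
      low = subst (_≤ ∑ n (λ i → P (suc i) + Q i)) (trans (∑-const n 0ℤ) (*-zeroʳ (+ n))) (∑-mono< n pt′)
        where
        eq : ∀ u v w d a → d * d * (a - (u + v + w) + (a * + 3 - v * + 4))
          ≡ d * d * (a * + 4 - v * + 5 - w) + - (u * (d * d))
        eq = solve-∀
        pt′ : ∀ i → i ℕ.< n → 0ℤ ≤ P (suc i) + Q i
        pt′ i i<n = subst Nonneg (eq (u i) (u (suc i)) (u (suc (suc i))) (d (suc i)) a)
          (sq (d (suc i)) ⊗ (gap (triple≤a i) ⊕ gap (light′ i i<n)))
      P-per : P n ≡ P 0
      P-per = cong₂ (λ d v → d * d * v) (d-per 0) (cong₂ (λ u v → a * + 4 - u * + 5 - v) (u-per 0) (u-per 1))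
      shifted : ∑ n (λ i → P (suc i) + Q i) ≡ ∑ n (λ i → P i + Q i)
      shifted = trans (∑-+ n (λ i → P (suc i)) Q) (trans (cong (λ p → p + ∑ n Q) (∑-cyclic n P P-per)) (sym (∑-+ n P Q)))
      pt : ∀ i → P i + Q i ≤ δ i
      pt i = ≤-by _ (eq (u i) (u (suc i)) (d i) (d (suc i)) a) (u≥0 i ⊗ sq (d i - d (suc i)))
        where
        eq : ∀ u v d e a → d * d * (a - u) * + 4 - d * d * v - u * d * e * + 2
          - (d * d * (a * + 4 - u * + 5 - v) + - (u * (e * e))) ≡ u * ((d - e) * (d - e))
        eq = solve-∀

    cell : ∀ i → (pair i + gain i) * + 432
      ≤ u i * u i * (a * + 108) + u i * u i * u i * - (+ 108) + u i * u i * u (suc i) * + 27 - δ i * + 27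
    cell i = ≤-by _ (eq (y₁ i) (y₂ i) (z₁ i) (z₂ i) (y (suc i)) (z (suc i)) a)
      ((sq (y₁ i - y₂ i) ⊗ y≥0 (suc i) ⊕ sq (z₁ i - z₂ i) ⊗ z≥0 (suc i)) ⊗ nn 108)
      where
      eq : ∀ y₁ y₂ z₁ z₂ v w a →
        let u = y₁ + y₂ + (z₁ + z₂); d = y₁ + y₂ - (z₁ + z₂) in
        u * u * (a * + 108) + u * u * u * - (+ 108) + u * u * (v + w) * + 27
          - (d * d * (a - u) * + 4 - d * d * (v + w) - u * d * (v - w) * + 2) * + 27
          - ((y₁ + y₂) * (z₁ + z₂) * (a - u) + (y₁ * y₂ * v + z₁ * z₂ * w)) * + 432
        ≡ ((y₁ - y₂) * (y₁ - y₂) * v + (z₁ - z₂) * (z₁ - z₂) * w) * + 108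
      eq = solve-∀

    cells : ∑ n (λ i → pair i + gain i) * + 432 ≤ U * (a * + 108) + C * - (+ 108) + S * + 27
    cells = ≤-trans (subst₂ _≤_ lhs rhs (∑-mono n cell))
      (≤-by _ (eq (U * (a * + 108) + C * - (+ 108) + S * + 27) (∑ n δ)) (δ≥0 ⊗ nn 27))
      where
      eq : ∀ x e → x - (x - e * + 27) ≡ e * + 27
      eq = solve-∀
      g : ℕ → ℤ
      g i = u i * u i * (a * + 108) + u i * u i * u i * - (+ 108) + u i * u i * u (suc i) * + 27
      lhs : ∑ n (λ i → (pair i + gain i) * + 432) ≡ ∑ n (λ i → pair i + gain i) * + 432
      lhs = trans (∑-cong n (λ i → *-comm (pair i + gain i) (+ 432)))
        (trans (∑-* n (+ 432) (λ i → pair i + gain i)) (*-comm (+ 432) (∑ n (λ i → pair i + gain i))))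
      neg : ∀ e → - (e * + 27) ≡ - (+ 27) * e
      neg = solve-∀
      rhs : ∑ n (λ i → g i - δ i * + 27) ≡ U * (a * + 108) + C * - (+ 108) + S * + 27 - ∑ n δ * + 27
      rhs = trans (∑-+ n g (λ i → - (δ i * + 27)))
        (cong₂ _+_ (∑-lin n (a * + 108) (- (+ 108)) (+ 27) (λ i → u i * u i) (λ i → u i * u i * u i) (λ i → u i * u i * u (suc i)))
          (trans (∑-cong n (λ i → neg (δ i))) (trans (∑-* n (- (+ 27)) δ) (sym (neg (∑ n δ))))))

    -- For the edge polynomial `e` this says `6e ≤ (4/9 + 1/(8n)) N³`. The identity `eq` combines
    -- the bound for the cells with the energy; the factor 192 turns the 9 into the 1728 of
    -- `energy-lower`.
    light-bound : twice-edges * + 216 * + n ≤ cube N * (+ n * + 32 + + 9)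
    light-bound = ≤-by-scaled 191 _ (eq a b U C S (∑ n (λ i → pair i + gain i)) (+ n))
      (nn n ⊗ gap cells ⊗ nn 192 ⊕ gap energy-lower)
      where
      eq : ∀ a b U C S G n → let N = a + b; r = a - b * + 2 in
        (N * N * N * (n * + 32 + + 9) - (b * (a * a - U) + G * + 2) * + 216 * n) * + 192
        ≡ n * (U * (a * + 108) + C * - (+ 108) + S * + 27 - G * + 432) * + 192
          + (n * (((C * + 144 - U * (r * + 192) + a * (r * r * + 64)) * + 36 + (C - S) * + 1728) * + 3) + N * N * N * + 1728
             - n * (r * r * r * + 768))
      eq = solve-∀

  module Heavy (m : ℕ) (m<n : m ℕ.< n) (heavy : a * + 3 ≤ u m * + 4) where

    pair≤a : ∀ i → u i + u (suc i) ≤ a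
    pair≤a i = ≤-trans (≤-by _ (eq (u i) (u (suc i)) (u (suc (suc i)))) (u≥0 (suc (suc i)))) (triple≤a i)
      where
      eq : ∀ u v w → u + v + w - (u + v) ≡ w
      eq = solve-∀

    -- A cruder estimate than in the light case: `y′ + z′ ≤ a - u`, so everything is at most `a - u`
    -- times the larger of `yz + y²/4` and `yz + z²/4`. Both are at most `u²/3`, the first with
    -- equality at `y = 2z`.
    cell : ∀ i → (pair i + gain i) * + 432 ≤ u i * u i * (a * + 144) + u i * u i * u i * - (+ 144) + u i * 0ℤ
    cell i = ≤-by _ (eq (y₁ i) (y₂ i) (z₁ i) (z₂ i) (y (suc i)) (z (suc i)) a)
      (y≥0 (suc i) ⊗ (sq (y i - z i * + 2) ⊗ nn 36 ⊕ sq (y₁ i - y₂ i) ⊗ nn 108)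
       ⊕ z≥0 (suc i) ⊗ (sq (z i - y i * + 2) ⊗ nn 36 ⊕ sq (z₁ i - z₂ i) ⊗ nn 108)
       ⊕ gap (pair≤a i) ⊗ (sq (y i - z i) ⊕ y≥0 i ⊗ z≥0 i) ⊗ nn 144)
      where
      eq : ∀ y₁ y₂ z₁ z₂ v w a →
        let y = y₁ + y₂; z = z₁ + z₂; u = y + z in
        u * u * (a * + 144) + u * u * u * - (+ 144) + u * 0ℤ
          - (y * z * (a - u) + (y₁ * y₂ * v + z₁ * z₂ * w)) * + 432
        ≡ v * ((y - z * + 2) * (y - z * + 2) * + 36 + (y₁ - y₂) * (y₁ - y₂) * + 108)
          + w * ((z - y * + 2) * (z - y * + 2) * + 36 + (z₁ - z₂) * (z₁ - z₂) * + 108)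
          + (a - (u + (v + w))) * ((y - z) * (y - z) + y * z) * + 144
      eq = solve-∀

    cells : ∑ n (λ i → pair i + gain i) * + 432 ≤ U * (a * + 144) + C * - (+ 144) + a * 0ℤ
    cells = subst₂ _≤_ lhs (∑-lin n (a * + 144) (- (+ 144)) 0ℤ (λ i → u i * u i) (λ i → u i * u i * u i) u) (∑-mono n cell)
      where
      lhs : ∑ n (λ i → (pair i + gain i) * + 432) ≡ ∑ n (λ i → pair i + gain i) * + 432
      lhs = trans (∑-cong n (λ i → *-comm (pair i + gain i) (+ 432)))
        (trans (∑-* n (+ 432) (λ i → pair i + gain i)) (*-comm (+ 432) (∑ n (λ i → pair i + gain i))))

    v : ℕ → ℤ
    v = mask m u
    M t U′ C′ : ℤ
    M = u m
    t = ∑ n v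
    U′ = ∑ n (λ i → v i * v i)
    C′ = ∑ n (λ i → v i * v i * v i)

    v≥0 : ∀ i → Nonneg (v i)
    v≥0 = mask-nonneg m u≥0
    a≡ : a ≡ M + t
    a≡ = ∑-mask n m u m<n
    U≡ : U ≡ M * M + U′
    U≡ = trans (∑-mask n m (λ i → u i * u i) m<n) (cong (λ s → M * M + s) (∑-cong n (mask-map m (λ s → s * s) refl u)))
    C≡ : C ≡ M * M * M + C′
    C≡ = trans (∑-mask n m (λ i → u i * u i * u i) m<n) (cong (λ s → M * M * M + s) (∑-cong n (mask-map m (λ s → s * s * s) refl u)))
    t≥0 : Nonneg t
    t≥0 = ∑-nonneg n v≥0
    3t≤M : t * + 3 ≤ M
    3t≤M = ≤-by _ (eq M t) (gap (subst (λ α → α * + 3 ≤ M * + 4) a≡ heavy))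
      where
      eq : ∀ M t → M - t * + 3 ≡ M * + 4 - (M + t) * + 3
      eq = solve-∀

    -- With a heavy cell `6e` does not even exceed `4/9 N³`, as `main` shows. The other cells enter
    -- only through `0 ≤ U′ ≤ t²` and `C′ ≥ 0`; after `M = 3t + s` all coefficients in `t`, `s`, `b`
    -- are nonnegative.
    heavy-bound : twice-edges * + 216 * + n ≤ cube N * (+ n * + 32 + + 9)
    heavy-bound = ≤-by _ (eq₀ twice-edges (+ n) (cube N))
        (nn n ⊗ gap main ⊕ N≥0 ⊗ N≥0 ⊗ N≥0 ⊗ nn 9)
      where
      eq₀ : ∀ e n N → N * (n * + 32 + + 9) - e * + 216 * n ≡ n * (N * + 32 - e * + 216) + N * + 9
      eq₀ = solve-∀
      eq : ∀ M t b U′ C′ G → let a = M + t; U = M * M + U′; C = M * M * M + C′; N = a + b; s = M - t * + 3 in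
        N * N * N * + 32 - (b * (a * a - U) + G * + 2) * + 216
        ≡ (U * (a * + 144) + C * - (+ 144) + a * 0ℤ - G * + 432)
          + (b * U′ * + 216 + C′ * + 144 + a * (t * t - U′) * + 144)
          + (t * t * t * + 176 + t * t * s * + 528 + t * s * s * + 240 + s * s * s * + 32)
          + b * (t * t * + 24 + t * s * + 336 + s * s * + 96) + b * b * a * + 96 + b * b * b * + 32
      eq = solve-∀
      pt = t≥0
      ps = gap 3t≤M
      main : twice-edges * + 216 ≤ cube N * + 32
      main = ≤-by _ (trans (cong₂ (λ α υ → (α + b) * (α + b) * (α + b) * + 32 - (b * (α * α - υ) + ∑ n (λ i → pair i + gain i) * + 2) * + 216) a≡ U≡)
                 (eq M t b U′ C′ (∑ n (λ i → pair i + gain i))))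
        (gap (subst (λ c → ∑ n (λ i → pair i + gain i) * + 432 ≤ c)
               (trans (cong₂ (λ υ γ → υ * (a * + 144) + γ * - (+ 144) + a * 0ℤ) U≡ C≡)
                      (cong (λ α → (M * M + U′) * (α * + 144) + (M * M * M + C′) * - (+ 144) + α * 0ℤ) a≡)) cells)
         ⊕ (b≥0 ⊗ ∑-nonneg n (λ i → v≥0 i ⊗ v≥0 i) ⊗ nn 216 ⊕ ∑-nonneg n (λ i → v≥0 i ⊗ v≥0 i ⊗ v≥0 i) ⊗ nn 144
            ⊕ subst Nonneg a≡ a≥0 ⊗ gap (∑-sq≤ n v≥0) ⊗ nn 144)
         ⊕ (pt ⊗ pt ⊗ pt ⊗ nn 176 ⊕ pt ⊗ pt ⊗ ps ⊗ nn 528 ⊕ pt ⊗ ps ⊗ ps ⊗ nn 240 ⊕ ps ⊗ ps ⊗ ps ⊗ nn 32)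
         ⊕ b≥0 ⊗ (sq t ⊗ nn 24 ⊕ pt ⊗ ps ⊗ nn 336 ⊕ sq (M - t * + 3) ⊗ nn 96) ⊕ sq b ⊗ subst Nonneg a≡ a≥0 ⊗ nn 96 ⊕ b≥0 ⊗ b≥0 ⊗ b≥0 ⊗ nn 32)

  edge-bound : twice-edges * + 216 * + n ≤ cube N * (+ n * + 32 + + 9)
  edge-bound with all-or-some n (λ i → u i * + 4) (a * + 3)
  ... | inj₁ light             = Light.light-bound light
  ... | inj₂ (m , m<n , heavy) = Heavy.heavy-bound m m<n heavy

-- The pattern

-- The cell i consists of y¹, y² = cell i false _ and z¹, z² = cell i true _; indices i ≥ n lie in no edge.
data Color : Set where
  base : Color
  cell : (index : ℕ) (side copy : Bool) → Color

third : ℕ → ℕ → ℕ → Bool → Bool → Bool → Bool → ℕ → Bool → Bool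
third n next i false c     true  c′   j s = does (j ℕ.<? n) ∧ not (does (j ℕ.≟ i))
third n next i false false false true j s = does (j ℕ.≟ next) ∧ not s
third n next i true  false true  true j s = does (j ℕ.≟ next) ∧ s
third n next i _     _     _     _    j s = false

-- The edges of the pattern with n cells, each listed with its vertices in one order.
role : (n : ℕ) .{{_ : ℕ.NonZero n}} → Color → Color → Color → Bool
role n base          (cell i _ _)    (cell j _ _) = does (i ℕ.<? n) ∧ does (j ℕ.<? i)
role n (cell i s c)  (cell i′ s′ c′) (cell j t _) = does (i ℕ.<? n) ∧ does (i′ ℕ.≟ i) ∧ third n (suc i % n) i s c s′ c′ j t
role n _             _               _            = false

⟦_⟧ : Bool → ℤ
⟦ true  ⟧ = 1ℤ
⟦ false ⟧ = 0ℤ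

⟦⟧-nonneg : ∀ b → Nonneg ⟦ b ⟧
⟦⟧-nonneg true  = nn 1
⟦⟧-nonneg false = nn 0

-- Sums over lists

sumL : ∀ {A : Set} → List A → (A → ℤ) → ℤ
sumL []       f = 0ℤ
sumL (x ∷ xs) f = f x + sumL xs f

module _ {A : Set} where

  sumL-cong : ∀ (xs : List A) {f g} → (∀ x → f x ≡ g x) → sumL xs f ≡ sumL xs g
  sumL-cong []       p = refl
  sumL-cong (x ∷ xs) p = cong₂ _+_ (p x) (sumL-cong xs p)

  sumL-mono : ∀ (xs : List A) {f g} → (∀ x → f x ≤ g x) → sumL xs f ≤ sumL xs g
  sumL-mono []       p = ≤-refl
  sumL-mono (x ∷ xs) p = +-mono-≤ (p x) (sumL-mono xs p)

  sumL-nonneg : ∀ (xs : List A) {f} → (∀ x → Nonneg (f x)) → Nonneg (sumL xs f)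
  sumL-nonneg []       p = nn 0
  sumL-nonneg (x ∷ xs) p = p x ⊕ sumL-nonneg xs p

  sumL-++ : ∀ (xs ys : List A) f → sumL (xs ++ ys) f ≡ sumL xs f + sumL ys f
  sumL-++ []       ys f = sym (+-identityˡ (sumL ys f))
  sumL-++ (x ∷ xs) ys f = trans (cong (λ s → f x + s) (sumL-++ xs ys f)) (sym (+-assoc (f x) (sumL xs f) (sumL ys f)))

  sumL-const1 : ∀ (xs : List A) → sumL xs (λ _ → 1ℤ) ≡ + length xs
  sumL-const1 []       = refl
  sumL-const1 (x ∷ xs) = cong (λ s → 1ℤ + s) (sumL-const1 xs)

∑-cong< : ∀ n {f g} → (∀ i → i ℕ.< n → f i ≡ g i) → ∑ n f ≡ ∑ n g
∑-cong< zero    p = refl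
∑-cong< (suc n) p = cong₂ _+_ (∑-cong< n (λ i i<n → p i (ℕₚ.m<n⇒m<1+n i<n))) (p n ℕₚ.≤-refl)

∑-zero : ∀ n → ∑ n (λ _ → 0ℤ) ≡ 0ℤ
∑-zero n = trans (∑-const n 0ℤ) (*-zeroʳ (+ n))

*-bracket-true : ∀ {P : Set} (d : Dec P) x → P → ⟦ does d ⟧ * x ≡ x
*-bracket-true d x p = trans (cong (λ b → ⟦ b ⟧ * x) (dec-true d p)) (*-identityˡ x)

*-bracket-false : ∀ {P : Set} (d : Dec P) x → ¬ P → ⟦ does d ⟧ * x ≡ 0ℤ
*-bracket-false d x ¬p = trans (cong (λ b → ⟦ b ⟧ * x) (dec-false d ¬p)) (*-zeroˡ x)

∑-δ-≥ : ∀ n m (f : ℕ → ℤ) → n ℕ.≤ m → ∑ n (λ i → ⟦ does (i ℕ.≟ m) ⟧ * f i) ≡ 0ℤ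
∑-δ-≥ n m f n≤m = trans (∑-cong< n (λ i i<n →
  *-bracket-false (i ℕ.≟ m) (f i) (λ { refl → ℕₚ.<-irrefl refl (ℕₚ.<-≤-trans i<n n≤m) }))) (∑-zero n)

∑-δ : ∀ n m (f : ℕ → ℤ) → m ℕ.< n → ∑ n (λ i → ⟦ does (i ℕ.≟ m) ⟧ * f i) ≡ f m
∑-δ (suc n) m f m<1+n with ℕₚ.m≤n⇒m<n∨m≡n (ℕ.s≤s⁻¹ m<1+n)
... | inj₂ refl = trans (cong₂ _+_ (∑-δ-≥ n n f ℕₚ.≤-refl) (*-bracket-true (n ℕ.≟ n) (f n) refl)) (+-identityˡ (f n))
... | inj₁ m<n  = trans (cong₂ _+_ (∑-δ n m f m<n) (*-bracket-false (n ℕ.≟ m) (f n) (λ { refl → ℕₚ.<-irrefl refl m<n }))) (+-identityʳ (f m))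

∑-below : ∀ n m (f : ℕ → ℤ) → m ℕ.≤ n → ∑ n (λ i → ⟦ does (i ℕ.<? m) ⟧ * f i) ≡ ∑ m f
∑-below zero    zero f _ = refl
∑-below (suc n) m    f m≤1+n with ℕₚ.m≤n⇒m<n∨m≡n m≤1+n
... | inj₂ refl  = ∑-cong< (suc n) (λ i i<n → *-bracket-true (i ℕ.<? suc n) (f i) i<n)
... | inj₁ m<1+n = trans (cong₂ _+_ (∑-below n m f (ℕ.s≤s⁻¹ m<1+n))
      (*-bracket-false (n ℕ.<? m) (f n) (ℕₚ.≤⇒≯ (ℕ.s≤s⁻¹ m<1+n)))) (+-identityʳ (∑ m f))

∑-except : ∀ n m (f : ℕ → ℤ) → m ℕ.< n → ∑ n (λ i → ⟦ not (does (i ℕ.≟ m)) ⟧ * f i) ≡ ∑ n f - f m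
∑-except n m f m<n = trans (eq₀ (∑ n (λ i → ⟦ not (does (i ℕ.≟ m)) ⟧ * f i)) (f m)) (cong (_- f m)
    (trans (cong (λ s → ∑ n (λ i → ⟦ not (does (i ℕ.≟ m)) ⟧ * f i) + s) (sym (∑-δ n m f m<n)))
      (trans (sym (∑-+ n (λ i → ⟦ not (does (i ℕ.≟ m)) ⟧ * f i) (λ i → ⟦ does (i ℕ.≟ m) ⟧ * f i)))
        (∑-cong n (λ i → eq (does (i ℕ.≟ m)) (f i))))))
  where
  eq₀ : ∀ a b → a ≡ a + b - b
  eq₀ = solve-∀
  eq : ∀ b x → ⟦ not b ⟧ * x + ⟦ b ⟧ * x ≡ x
  eq true  x = trans (cong₂ _+_ (*-zeroˡ x) (*-identityˡ x)) (+-identityˡ x)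
  eq false x = trans (cong₂ _+_ (*-identityˡ x) (*-zeroˡ x)) (+-identityʳ x)

-- Summation against a weighting of the colours

quad : (Bool → Bool → ℤ) → ℤ
quad f = f false false + f false true + (f true false + f true true)

Weights : Set
Weights = ℕ → Bool → Bool → ℤ

weighted : ℕ → ℤ → Weights → (Color → ℤ) → ℤ
weighted n b c g = b * g base + ∑ n (λ i → quad (λ s t → c i s t * g (cell i s t)))

quad-cong : ∀ {f g : Bool → Bool → ℤ} → (∀ s t → f s t ≡ g s t) → quad f ≡ quad g
quad-cong p = cong₂ _+_ (cong₂ _+_ (p false false) (p false true)) (cong₂ _+_ (p true false) (p true true))

quad-+ : ∀ (f g : Bool → Bool → ℤ) → quad (λ s t → f s t + g s t) ≡ quad f + quad g
quad-+ f g = eq (f false false) (f false true) (f true false) (f true true) (g false false) (g false true) (g true false) (g true true)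
  where
  eq : ∀ a b c d a′ b′ c′ d′ → a + a′ + (b + b′) + (c + c′ + (d + d′)) ≡ a + b + (c + d) + (a′ + b′ + (c′ + d′))
  eq = solve-∀

quad-* : ∀ k (f : Bool → Bool → ℤ) → quad (λ s t → k * f s t) ≡ k * quad f
quad-* k f = eq k (f false false) (f false true) (f true false) (f true true)
  where
  eq : ∀ k a b c d → k * a + k * b + (k * c + k * d) ≡ k * (a + b + (c + d))
  eq = solve-∀

quad-zero : ∀ {f : Bool → Bool → ℤ} → (∀ s t → f s t ≡ 0ℤ) → quad f ≡ 0ℤ
quad-zero p = quad-cong {g = λ _ _ → 0ℤ} p

isBase : Color → Bool
isBase base = true
isBase _    = false

_≡ᵇ_ : Bool → Bool → Bool
true  ≡ᵇ b = b
false ≡ᵇ b = not b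

isCell : ℕ → Bool → Bool → Color → ℤ
isCell i s t base            = 0ℤ
isCell i s t (cell i′ s′ t′) = ⟦ does (i ℕ.≟ i′) ⟧ * ⟦ (s ≡ᵇ s′) ∧ (t ≡ᵇ t′) ⟧

quad-δ : ∀ s t (f : Bool → Bool → ℤ) → quad (λ s′ t′ → ⟦ (s′ ≡ᵇ s) ∧ (t′ ≡ᵇ t) ⟧ * f s′ t′) ≡ f s t
quad-δ false false f = eq (f false false) (f false true) (f true false) (f true true)
  where
  eq : ∀ a b c d → 1ℤ * a + 0ℤ * b + (0ℤ * c + 0ℤ * d) ≡ a
  eq = solve-∀
quad-δ false true f = eq (f false false) (f false true) (f true false) (f true true)
  where
  eq : ∀ a b c d → 0ℤ * a + 1ℤ * b + (0ℤ * c + 0ℤ * d) ≡ b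
  eq = solve-∀
quad-δ true false f = eq (f false false) (f false true) (f true false) (f true true)
  where
  eq : ∀ a b c d → 0ℤ * a + 0ℤ * b + (1ℤ * c + 0ℤ * d) ≡ c
  eq = solve-∀
quad-δ true true f = eq (f false false) (f false true) (f true false) (f true true)
  where
  eq : ∀ a b c d → 0ℤ * a + 0ℤ * b + (0ℤ * c + 1ℤ * d) ≡ d
  eq = solve-∀

-- Integration against the point mass at `α`. The weighting sees only cells below `n`, so `g` has to
-- vanish on the others.
weighted-point : ∀ n α g → (∀ i s t → n ℕ.≤ i → g (cell i s t) ≡ 0ℤ) →
  weighted n ⟦ isBase α ⟧ (λ i s t → isCell i s t α) g ≡ g α
weighted-point n base g p = trans (cong₂ _+_ (*-identityˡ (g base))
    (trans (∑-cong n (λ i → quad-zero (λ s t → *-zeroˡ (g (cell i s t))))) (∑-zero n))) (+-identityʳ (g base))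
weighted-point n (cell i₀ s₀ t₀) g p = trans (cong (λ s → s + ∑ n (λ i → quad (λ s t → isCell i s t (cell i₀ s₀ t₀) * g (cell i s t)))) (*-zeroˡ (g base)))
    (trans (+-identityˡ _) (trans (∑-cong n inner) (outer (i₀ ℕ.<? n))))
  where
  inner : ∀ i → quad (λ s t → isCell i s t (cell i₀ s₀ t₀) * g (cell i s t)) ≡ ⟦ does (i ℕ.≟ i₀) ⟧ * g (cell i s₀ t₀)
  inner i = trans (quad-cong (λ s t → *-assoc ⟦ does (i ℕ.≟ i₀) ⟧ ⟦ (s ≡ᵇ s₀) ∧ (t ≡ᵇ t₀) ⟧ (g (cell i s t))))
    (trans (quad-* ⟦ does (i ℕ.≟ i₀) ⟧ (λ s t → ⟦ (s ≡ᵇ s₀) ∧ (t ≡ᵇ t₀) ⟧ * g (cell i s t)))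
      (cong (⟦ does (i ℕ.≟ i₀) ⟧ *_) (quad-δ s₀ t₀ (λ s t → g (cell i s t)))))
  outer : _ → ∑ n (λ i → ⟦ does (i ℕ.≟ i₀) ⟧ * g (cell i s₀ t₀)) ≡ g (cell i₀ s₀ t₀)
  outer (yes i₀<n) = ∑-δ n i₀ (λ i → g (cell i s₀ t₀)) i₀<n
  outer (no  i₀≮n) = trans (∑-δ-≥ n i₀ (λ i → g (cell i s₀ t₀)) (ℕₚ.≮⇒≥ i₀≮n)) (sym (p i₀ s₀ t₀ (ℕₚ.≮⇒≥ i₀≮n)))

weighted-+ : ∀ n b b′ c c′ g → weighted n (b + b′) (λ i s t → c i s t + c′ i s t) g ≡ weighted n b c g + weighted n b′ c′ g
weighted-+ n b b′ c c′ g = trans (cong₂ _+_ (*-distribʳ-+ (g base) b b′)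
    (trans (∑-cong n (λ i → trans (quad-cong (λ s t → *-distribʳ-+ (g (cell i s t)) (c i s t) (c′ i s t)))
        (quad-+ (λ s t → c i s t * g (cell i s t)) (λ s t → c′ i s t * g (cell i s t)))))
      (∑-+ n (λ i → quad (λ s t → c i s t * g (cell i s t))) (λ i → quad (λ s t → c′ i s t * g (cell i s t))))))
    (eq (b * g base) (b′ * g base) _ _)
  where
  eq : ∀ a b c d → a + b + (c + d) ≡ a + c + (b + d)
  eq = solve-∀

countBase : List Color → ℤ
countBase L = sumL L (λ α → ⟦ isBase α ⟧)

countCell : List Color → Weights
countCell L i s t = sumL L (isCell i s t)

countCell-nonneg : ∀ L i s t → Nonneg (countCell L i s t)
countCell-nonneg L i s t = sumL-nonneg L p
  where
  p : ∀ α → Nonneg (isCell i s t α)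
  p base            = nn 0
  p (cell i′ s′ t′) = ⟦⟧-nonneg (does (i ℕ.≟ i′)) ⊗ ⟦⟧-nonneg ((s ≡ᵇ s′) ∧ (t ≡ᵇ t′))

-- The sum of the point masses of the members of `L`. Through it, counting edges becomes evaluating
-- the edge polynomial at the multiplicities of the colours.
sumL-weighted : ∀ n L g → (∀ i s t → n ℕ.≤ i → g (cell i s t) ≡ 0ℤ) →
  sumL L g ≡ weighted n (countBase L) (countCell L) g
sumL-weighted n []      g p = sym (trans (cong₂ _+_ (*-zeroˡ (g base))
  (trans (∑-cong n (λ i → quad-zero (λ s t → *-zeroˡ (g (cell i s t))))) (∑-zero n))) refl)
sumL-weighted n (α ∷ L) g p = sym (trans (weighted-+ n ⟦ isBase α ⟧ (countBase L) (λ i s t → isCell i s t α) (countCell L) g)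
  (cong₂ _+_ (weighted-point n α g p) (sym (sumL-weighted n L g p))))

-- Evaluation of the edge polynomial

⟦∧⟧ : ∀ x y → ⟦ x ∧ y ⟧ ≡ ⟦ x ⟧ * ⟦ y ⟧
⟦∧⟧ true  y = sym (*-identityˡ ⟦ y ⟧)
⟦∧⟧ false y = sym (*-zeroˡ ⟦ y ⟧)

quad-*ʳ : ∀ (f : Bool → Bool → ℤ) k → quad (λ s t → f s t * k) ≡ k * quad f
quad-*ʳ f k = trans (quad-cong (λ s t → *-comm (f s t) k)) (quad-* k f)

weighted-zero : ∀ n b c (g : Color → ℤ) → (∀ α → g α ≡ 0ℤ) → weighted n b c g ≡ 0ℤ
weighted-zero n b c g p = cong₂ _+_ (trans (cong (b *_) (p base)) (*-zeroʳ b))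
  (trans (∑-cong n (λ i → quad-zero (λ s t → trans (cong (c i s t *_) (p (cell i s t))) (*-zeroʳ (c i s t))))) (∑-zero n))

-- The edge polynomial of the pattern. No factor 6 arises, because `role` accepts each edge in one
-- order only.
role-sum : (n : ℕ) .{{_ : ℕ.NonZero n}} → ℤ → Weights → ℤ
role-sum n b c = weighted n b c (λ α → weighted n b c (λ β → weighted n b c (λ γ → ⟦ role n α β γ ⟧)))

module RoleSum (n : ℕ) .{{_ : ℕ.NonZero n}} (b : ℤ) (c : Weights) where

  Y Z u : ℕ → ℤ
  Y i = c i false false + c i false true
  Z i = c i true false + c i true true
  u i = quad (c i)

  next : ℕ → ℕ
  next i = suc i % n

  inner : ℕ → Bool → Bool → Bool → Bool → ℤ
  inner i false t     true  t′   = ∑ n u - u i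
  inner i false false false true = Y (next i)
  inner i true  false true  true = Z (next i)
  inner i _     _     _     _    = 0ℤ

  vanish : ∑ n (λ j → quad (λ σ τ → c j σ τ * 0ℤ)) ≡ 0ℤ
  vanish = trans (∑-cong n (λ j → quad-zero (λ s t → *-zeroʳ (c j s t)))) (∑-zero n)

  third-sum : ∀ {i} → i ℕ.< n → ∀ s t s′ t′ →
    ∑ n (λ j → quad (λ σ τ → c j σ τ * ⟦ third n (next i) i s t s′ t′ j σ ⟧)) ≡ inner i s t s′ t′
  third-sum {i} i<n false t true t′ = trans (∑-cong< n pt) (∑-except n i u i<n)
    where
    pt : ∀ j → j ℕ.< n → quad (λ σ τ → c j σ τ * ⟦ does (j ℕ.<? n) ∧ not (does (j ℕ.≟ i)) ⟧) ≡ ⟦ not (does (j ℕ.≟ i)) ⟧ * u j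
    pt j j<n = trans (cong (λ x → quad (λ σ τ → c j σ τ * ⟦ x ∧ not (does (j ℕ.≟ i)) ⟧)) (dec-true (j ℕ.<? n) j<n))
      (quad-*ʳ (c j) ⟦ not (does (j ℕ.≟ i)) ⟧)
  third-sum {i} i<n false false false true = trans (∑-cong n pt) (∑-δ n (next i) Y (m%n<n (suc i) n))
    where
    eq : ∀ d p q r s → p * (d * 1ℤ) + q * (d * 1ℤ) + (r * (d * 0ℤ) + s * (d * 0ℤ)) ≡ d * (p + q)
    eq = solve-∀
    pt : ∀ j → quad (λ σ τ → c j σ τ * ⟦ does (j ℕ.≟ next i) ∧ not σ ⟧) ≡ ⟦ does (j ℕ.≟ next i) ⟧ * Y j
    pt j = trans (quad-cong (λ σ τ → cong (c j σ τ *_) (⟦∧⟧ (does (j ℕ.≟ next i)) (not σ))))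
      (eq ⟦ does (j ℕ.≟ next i) ⟧ (c j false false) (c j false true) (c j true false) (c j true true))
  third-sum {i} i<n true false true true = trans (∑-cong n pt) (∑-δ n (next i) Z (m%n<n (suc i) n))
    where
    eq : ∀ d p q r s → p * (d * 0ℤ) + q * (d * 0ℤ) + (r * (d * 1ℤ) + s * (d * 1ℤ)) ≡ d * (r + s)
    eq = solve-∀
    pt : ∀ j → quad (λ σ τ → c j σ τ * ⟦ does (j ℕ.≟ next i) ∧ σ ⟧) ≡ ⟦ does (j ℕ.≟ next i) ⟧ * Z j
    pt j = trans (quad-cong (λ σ τ → cong (c j σ τ *_) (⟦∧⟧ (does (j ℕ.≟ next i)) σ)))
      (eq ⟦ does (j ℕ.≟ next i) ⟧ (c j false false) (c j false true) (c j true false) (c j true true))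
  third-sum i<n false false false false = vanish
  third-sum i<n false true  false false = vanish
  third-sum i<n false true  false true  = vanish
  third-sum i<n true  false false false = vanish
  third-sum i<n true  false false true  = vanish
  third-sum i<n true  false true  false = vanish
  third-sum i<n true  true  false false = vanish
  third-sum i<n true  true  false true  = vanish
  third-sum i<n true  true  true  false = vanish
  third-sum i<n true  true  true  true  = vanish

  cell-cell : ∀ {i} → i ℕ.< n → ∀ s t i′ s′ t′ →
    weighted n b c (λ γ → ⟦ role n (cell i s t) (cell i′ s′ t′) γ ⟧) ≡ ⟦ does (i′ ℕ.≟ i) ⟧ * inner i s t s′ t′
  cell-cell {i} i<n s t i′ s′ t′ = trans (cong₂ _+_ (*-zeroʳ b) (trans (∑-cong n pt)
      (trans (∑-* n ⟦ does (i′ ℕ.≟ i) ⟧ q) (cong (⟦ does (i′ ℕ.≟ i) ⟧ *_) (third-sum i<n s t s′ t′)))))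
      (+-identityˡ (⟦ does (i′ ℕ.≟ i) ⟧ * inner i s t s′ t′))
    where
    q : ℕ → ℤ
    q j = quad (λ σ τ → c j σ τ * ⟦ third n (next i) i s t s′ t′ j σ ⟧)
    comm : ∀ x d y → x * (d * y) ≡ d * (x * y)
    comm = solve-∀
    pt : ∀ j → quad (λ σ τ → c j σ τ * ⟦ does (i ℕ.<? n) ∧ does (i′ ℕ.≟ i) ∧ third n (next i) i s t s′ t′ j σ ⟧)
      ≡ ⟦ does (i′ ℕ.≟ i) ⟧ * q j
    pt j = trans (quad-cong (λ σ τ → trans (cong (c j σ τ *_)
        (trans (cong (λ x → ⟦ x ∧ does (i′ ℕ.≟ i) ∧ third n (next i) i s t s′ t′ j σ ⟧) (dec-true (i ℕ.<? n) i<n))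
               (⟦∧⟧ (does (i′ ℕ.≟ i)) (third n (next i) i s t s′ t′ j σ))))
        (comm (c j σ τ) ⟦ does (i′ ℕ.≟ i) ⟧ ⟦ third n (next i) i s t s′ t′ j σ ⟧)))
      (quad-* ⟦ does (i′ ℕ.≟ i) ⟧ (λ σ τ → c j σ τ * ⟦ third n (next i) i s t s′ t′ j σ ⟧))

  base-cell : ∀ {i} → i ℕ.< n → ∀ s t → weighted n b c (λ γ → ⟦ role n base (cell i s t) γ ⟧) ≡ ∑ i u
  base-cell {i} i<n s t = trans (cong₂ _+_ (*-zeroʳ b) (trans (∑-cong n pt) (∑-below n i u (ℕₚ.<⇒≤ i<n)))) (+-identityˡ (∑ i u))
    where
    pt : ∀ j → quad (λ σ τ → c j σ τ * ⟦ does (i ℕ.<? n) ∧ does (j ℕ.<? i) ⟧) ≡ ⟦ does (j ℕ.<? i) ⟧ * u j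
    pt j = trans (cong (λ x → quad (λ σ τ → c j σ τ * ⟦ x ∧ does (j ℕ.<? i) ⟧)) (dec-true (i ℕ.<? n) i<n))
      (quad-*ʳ (c j) ⟦ does (j ℕ.<? i) ⟧)

  at-base : weighted n b c (λ β → weighted n b c (λ γ → ⟦ role n base β γ ⟧)) ≡ ∑ n (λ i → u i * ∑ i u)
  at-base = trans (cong₂ _+_ (trans (cong (b *_) (weighted-zero n b c (λ γ → ⟦ role n base base γ ⟧) (λ _ → refl))) (*-zeroʳ b))
      (∑-cong< n (λ i i<n → trans (quad-cong (λ s t → cong (c i s t *_) (base-cell i<n s t))) (trans (quad-*ʳ (c i) (∑ i u)) (*-comm (∑ i u) (u i))))))
    (+-identityˡ (∑ n (λ i → u i * ∑ i u)))

  at-cell : ∀ {i} → i ℕ.< n → ∀ s t → weighted n b c (λ β → weighted n b c (λ γ → ⟦ role n (cell i s t) β γ ⟧))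
    ≡ quad (λ s′ t′ → c i s′ t′ * inner i s t s′ t′)
  at-cell {i} i<n s t = trans (cong₂ _+_ (trans (cong (b *_) (weighted-zero n b c (λ γ → ⟦ role n (cell i s t) base γ ⟧) (λ _ → refl))) (*-zeroʳ b))
      (trans (∑-cong n pt) (∑-δ n i (λ i′ → quad (λ s′ t′ → c i′ s′ t′ * inner i s t s′ t′)) i<n)))
    (+-identityˡ (quad (λ s′ t′ → c i s′ t′ * inner i s t s′ t′)))
    where
    comm : ∀ x d y → x * (d * y) ≡ d * (x * y)
    comm = solve-∀
    pt : ∀ i′ → quad (λ s′ t′ → c i′ s′ t′ * weighted n b c (λ γ → ⟦ role n (cell i s t) (cell i′ s′ t′) γ ⟧))
      ≡ ⟦ does (i′ ℕ.≟ i) ⟧ * quad (λ s′ t′ → c i′ s′ t′ * inner i s t s′ t′)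
    pt i′ = trans (quad-cong (λ s′ t′ → trans (cong (c i′ s′ t′ *_) (cell-cell i<n s t i′ s′ t′)) (comm (c i′ s′ t′) ⟦ does (i′ ℕ.≟ i) ⟧ (inner i s t s′ t′))))
      (quad-* ⟦ does (i′ ℕ.≟ i) ⟧ (λ s′ t′ → c i′ s′ t′ * inner i s t s′ t′))

  role-sum-eval : role-sum n b c ≡ b * ∑ n (λ i → u i * ∑ i u)
    + ∑ n (λ i → Y i * Z i * (∑ n u - u i) + (c i false false * c i false true * Y (next i) + c i true false * c i true true * Z (next i)))
  role-sum-eval = cong₂ _+_ (cong (b *_) at-base) (∑-cong< n (λ i i<n →
      trans (quad-cong (λ s t → cong (c i s t *_) (at-cell i<n s t)))
        (eq (c i false false) (c i false true) (c i true false) (c i true true) (∑ n u - u i) (Y (next i)) (Z (next i)))))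
    where
    eq : ∀ p q r s x y z →
      p * (p * 0ℤ + q * y + (r * x + s * x)) + q * (p * 0ℤ + q * 0ℤ + (r * x + s * x))
        + (r * (p * 0ℤ + q * 0ℤ + (r * 0ℤ + s * z)) + s * (p * 0ℤ + q * 0ℤ + (r * 0ℤ + s * 0ℤ)))
      ≡ (p + q) * (r + s) * x + (p * q * y + r * s * z)
    eq = solve-∀

∑-pairs : ∀ n f → ∑ n (λ i → f i * ∑ i f) * + 2 ≡ ∑ n f * ∑ n f - ∑ n (λ i → f i * f i)
∑-pairs zero    f = refl
∑-pairs (suc n) f = trans (eq₁ (∑ n (λ i → f i * ∑ i f)) (f n) (∑ n f)) (trans (cong (λ s → s + f n * ∑ n f * + 2) (∑-pairs n f))
  (eq₂ (∑ n f) (∑ n (λ i → f i * f i)) (f n)))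
  where
  eq₁ : ∀ p x s → (p + x * s) * + 2 ≡ p * + 2 + x * s * + 2
  eq₁ = solve-∀
  eq₂ : ∀ s q x → s * s - q + x * s * + 2 ≡ (s + x) * (s + x) - (q + x * x)
  eq₂ = solve-∀

module _ (n : ℕ) .{{_ : ℕ.NonZero n}} (3≤n : 3 ℕ.≤ n) (b : ℤ) (b≥0 : Nonneg b)
         (c : Weights) (c≥0 : ∀ i s t → Nonneg (c i s t)) where

  private
    w : Bool → Bool → ℕ → ℤ
    -- `EdgeBound` works with periodic sequences, so the weights are read modulo `n`; at indices
    -- below `n` nothing changes.
    w s t i = c (i % n) s t
    w-per : ∀ s t i → w s t (i ℕ.+ n) ≡ w s t i
    w-per s t i = cong (λ j → c j s t) ([m+n]%n≡m%n i n)
    module B = EdgeBound n 3≤n b b≥0 (w false false) (w false true) (w true false) (w true true)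
      (λ i → c≥0 _ _ _) (λ i → c≥0 _ _ _) (λ i → c≥0 _ _ _) (λ i → c≥0 _ _ _)
      (w-per false false) (w-per false true) (w-per true false) (w-per true true)
    module R = RoleSum n b c
    mod : ∀ i → i ℕ.< n → i % n ≡ i
    mod i = m<n⇒m%n≡m
    u≡ : ∀ i → i ℕ.< n → R.u i ≡ B.u i
    u≡ i i<n = cong R.u (sym (mod i i<n))
    a≡ : ∑ n R.u ≡ B.a
    a≡ = ∑-cong< n u≡
    gain≡ : ∀ i → i ℕ.< n → R.Y i * R.Z i * (∑ n R.u - R.u i)
        + (c i false false * c i false true * R.Y (R.next i) + c i true false * c i true true * R.Z (R.next i))
      ≡ B.pair i + B.gain i
    gain≡ i i<n = cong₂ (λ j α → R.Y j * R.Z j * (α - R.u j)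
        + (c j false false * c j false true * R.Y (R.next i) + c j true false * c j true true * R.Z (R.next i))) (sym (mod i i<n)) a≡
    squares≡ : ∑ n (λ i → R.u i * R.u i) ≡ B.U
    squares≡ = ∑-cong< n (λ i i<n → cong₂ _*_ (u≡ i i<n) (u≡ i i<n))

    twice : ∀ e b p g s q α υ → e ≡ b * p + g → p * + 2 ≡ s * s - q → s ≡ α → q ≡ υ → e * + 2 ≡ b * (α * α - υ) + g * + 2
    twice _ b p g s q _ _ refl p≡ refl refl = trans (eq b p g) (cong (λ x → b * x + g * + 2) p≡)
      where
      eq : ∀ b p g → (b * p + g) * + 2 ≡ b * (p * + 2) + g * + 2
      eq = solve-∀

    rescale : ∀ e t s α b n x → e * + 2 ≡ t → s ≡ α → t * + 216 * n ≤ cube (α + b) * x → e * + 432 * n ≤ cube (s + b) * x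
    rescale e _ s _ b n x refl refl = subst (_≤ cube (s + b) * x) (eq e n)
      where
      eq : ∀ e n → e * + 2 * + 216 * n ≡ e * + 432 * n
      eq = solve-∀

  role-sum-twice : role-sum n b c * + 2 ≡ B.twice-edges
  role-sum-twice = trans
    (twice (role-sum n b c) b (∑ n (λ i → R.u i * ∑ i R.u)) _ (∑ n R.u) (∑ n (λ i → R.u i * R.u i)) B.a B.U
      R.role-sum-eval (∑-pairs n R.u) a≡ squares≡)
    (cong (λ g → b * (B.a * B.a - B.U) + g * + 2) (∑-cong< n gain≡))

  role-sum-bound : role-sum n b c * + 432 * + n ≤ cube (∑ n (λ i → quad (c i)) + b) * (+ n * + 32 + + 9)
  role-sum-bound = rescale (role-sum n b c) B.twice-edges (∑ n (λ i → quad (c i))) B.a b (+ n) (+ n * + 32 + + 9)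
    role-sum-twice a≡ B.edge-bound

-- Comparing the lengths of lists by a matching

lookup-injective : ∀ {A : Set} {xs : List A} → Unique xs → ∀ i j → lookup xs i ≡ lookup xs j → i ≡ j
lookup-injective (_  ∷ _)   Fin.zero    Fin.zero    eq = refl
lookup-injective (x∉ ∷ _)   Fin.zero    (Fin.suc j) eq = contradiction eq (All.lookup x∉ (∈-lookup j))
lookup-injective (x∉ ∷ _)   (Fin.suc i) Fin.zero    eq = contradiction (sym eq) (All.lookup x∉ (∈-lookup i))
lookup-injective (_  ∷ xs!) (Fin.suc i) (Fin.suc j) eq = cong Fin.suc (lookup-injective xs! i j eq)

module _ {A B : Set} {P : A → Set} {Q : A → B → Set} where

  ≤-by-matching : ∀ {xs ys} → Unique xs → All P xs → All (λ x → Any (Q x) ys) xs →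
    (∀ {x x′ y} → P x → P x′ → Q x y → Q x′ y → x ≡ x′) → length xs ℕ.≤ length ys
  ≤-by-matching {xs} {ys} xs! ps qs functional = Finₚ.injective⇒≤ {f = partner} λ {i} {j} eq →
      lookup-injective xs! i j (functional (at ps i) (at ps j) (match i) (subst (λ p → Q (lookup xs j) (lookup ys p)) (sym eq) (match j)))
    where
    at : ∀ {R : A → Set} → All R xs → ∀ i → R (lookup xs i)
    at rs i = All.lookup rs (∈-lookup i)
    partner : Fin (length xs) → Fin (length ys)
    partner i = Any.index (at qs i)
    match : ∀ i → Q (lookup xs i) (lookup ys (partner i))
    match i = lookup-index (at qs i)

-- Unordered triples

module _ {v : ℕ} where

  swap₁₂ : ∀ {x y z : Fin v} {t} → SameSet (x , y , z) t → SameSet (y , x , z) t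
  swap₁₂ (inj₁ (p , q , r)) = inj₂ (inj₂ (inj₁ (q , p , r)))
  swap₁₂ (inj₂ (inj₁ (p , q , r))) = inj₂ (inj₂ (inj₂ (inj₂ (inj₁ (q , p , r)))))
  swap₁₂ (inj₂ (inj₂ (inj₁ (p , q , r)))) = inj₁ (q , p , r)
  swap₁₂ (inj₂ (inj₂ (inj₂ (inj₁ (p , q , r))))) = inj₂ (inj₂ (inj₂ (inj₂ (inj₂ (q , p , r)))))
  swap₁₂ (inj₂ (inj₂ (inj₂ (inj₂ (inj₁ (p , q , r)))))) = inj₂ (inj₁ (q , p , r))
  swap₁₂ (inj₂ (inj₂ (inj₂ (inj₂ (inj₂ (p , q , r)))))) = inj₂ (inj₂ (inj₂ (inj₁ (q , p , r))))

  swap₂₃ : ∀ {x y z : Fin v} {t} → SameSet (x , y , z) t → SameSet (x , z , y) t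
  swap₂₃ (inj₁ (p , q , r)) = inj₂ (inj₁ (p , r , q))
  swap₂₃ (inj₂ (inj₁ (p , q , r))) = inj₁ (p , r , q)
  swap₂₃ (inj₂ (inj₂ (inj₁ (p , q , r)))) = inj₂ (inj₂ (inj₂ (inj₁ (p , r , q))))
  swap₂₃ (inj₂ (inj₂ (inj₂ (inj₁ (p , q , r))))) = inj₂ (inj₂ (inj₁ (p , r , q)))
  swap₂₃ (inj₂ (inj₂ (inj₂ (inj₂ (inj₁ (p , q , r)))))) = inj₂ (inj₂ (inj₂ (inj₂ (inj₂ (p , r , q)))))
  swap₂₃ (inj₂ (inj₂ (inj₂ (inj₂ (inj₂ (p , q , r)))))) = inj₂ (inj₂ (inj₂ (inj₂ (inj₁ (p , r , q)))))

  SameSet-refl : ∀ {t : Triple v} → SameSet t t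
  SameSet-refl = inj₁ (refl , refl , refl)

  SameSet-trans : ∀ {t t′ t″ : Triple v} → SameSet t t′ → SameSet t′ t″ → SameSet t t″
  SameSet-trans (inj₁ (refl , refl , refl)) = id
  SameSet-trans (inj₂ (inj₁ (refl , refl , refl))) = swap₂₃
  SameSet-trans (inj₂ (inj₂ (inj₁ (refl , refl , refl)))) = swap₁₂
  SameSet-trans (inj₂ (inj₂ (inj₂ (inj₁ (refl , refl , refl))))) = swap₂₃ ∘ swap₁₂
  SameSet-trans (inj₂ (inj₂ (inj₂ (inj₂ (inj₁ (refl , refl , refl)))))) = swap₁₂ ∘ swap₂₃
  SameSet-trans (inj₂ (inj₂ (inj₂ (inj₂ (inj₂ (refl , refl , refl)))))) = swap₁₂ ∘ swap₂₃ ∘ swap₁₂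

  SameSet-sym : ∀ {t t′ : Triple v} → SameSet t t′ → SameSet t′ t
  SameSet-sym (inj₁ (refl , refl , refl)) = SameSet-refl
  SameSet-sym (inj₂ (inj₁ (refl , refl , refl))) = swap₂₃ SameSet-refl
  SameSet-sym (inj₂ (inj₂ (inj₁ (refl , refl , refl)))) = swap₁₂ SameSet-refl
  SameSet-sym (inj₂ (inj₂ (inj₂ (inj₁ (refl , refl , refl))))) = swap₁₂ (swap₂₃ SameSet-refl)
  SameSet-sym (inj₂ (inj₂ (inj₂ (inj₂ (inj₁ (refl , refl , refl)))))) = swap₂₃ (swap₁₂ SameSet-refl)
  SameSet-sym (inj₂ (inj₂ (inj₂ (inj₂ (inj₂ (refl , refl , refl)))))) = swap₁₂ (swap₂₃ (swap₁₂ SameSet-refl))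

  increasing-unique : ∀ {t t′ : Triple v} → Increasing t → Increasing t′ → SameSet t t′ → t ≡ t′
  increasing-unique _ _ (inj₁ (refl , refl , refl)) = refl
  increasing-unique (_ , y<z) (_ , z<y) (inj₂ (inj₁ (refl , refl , refl))) = contradiction z<y (Finₚ.<-asym y<z)
  increasing-unique (x<y , _) (y<x , _) (inj₂ (inj₂ (inj₁ (refl , refl , refl)))) = contradiction y<x (Finₚ.<-asym x<y)
  increasing-unique (x<y , y<z) (z<x , x<y′) (inj₂ (inj₂ (inj₂ (inj₁ (refl , refl , refl))))) = contradiction z<x (Finₚ.<-asym (Finₚ.<-trans x<y y<z))
  increasing-unique (x<y , y<z) (_ , z<x) (inj₂ (inj₂ (inj₂ (inj₂ (inj₁ (refl , refl , refl)))))) = contradiction z<x (Finₚ.<-asym (Finₚ.<-trans x<y y<z))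
  increasing-unique (x<y , _) (_ , y<x) (inj₂ (inj₂ (inj₂ (inj₂ (inj₂ (refl , refl , refl)))))) = contradiction y<x (Finₚ.<-asym x<y)

  SameSet? : ∀ (t t′ : Triple v) → Dec (SameSet t t′)
  SameSet? (x , y , z) (a , b , c) =
    ((x Fin.≟ a) ×-dec (y Fin.≟ b) ×-dec (z Fin.≟ c)) ⊎-dec ((x Fin.≟ a) ×-dec (y Fin.≟ c) ×-dec (z Fin.≟ b)) ⊎-dec
    ((x Fin.≟ b) ×-dec (y Fin.≟ a) ×-dec (z Fin.≟ c)) ⊎-dec ((x Fin.≟ b) ×-dec (y Fin.≟ c) ×-dec (z Fin.≟ a)) ⊎-dec
    ((x Fin.≟ c) ×-dec (y Fin.≟ a) ×-dec (z Fin.≟ b)) ⊎-dec ((x Fin.≟ c) ×-dec (y Fin.≟ b) ×-dec (z Fin.≟ a))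

  Increasing? : ∀ (t : Triple v) → Dec (Increasing t)
  Increasing? (x , y , z) = (x Fin.<? y) ×-dec (y Fin.<? z)

  sort : ∀ {x y z : Fin v} → x ≢ y → x ≢ z → y ≢ z → ∃[ t ] Increasing t × SameSet (x , y , z) t
  sort {x} {y} {z} x≢y x≢z y≢z with Finₚ.<-cmp x y | Finₚ.<-cmp x z | Finₚ.<-cmp y z
  ... | tri≈ _ x≡y _ | _ | _ = contradiction x≡y x≢y
  ... | tri< _ _ _ | tri≈ _ x≡z _ | _ = contradiction x≡z x≢z
  ... | tri> _ _ _ | tri≈ _ x≡z _ | _ = contradiction x≡z x≢z
  ... | tri< _ _ _ | tri< _ _ _ | tri≈ _ y≡z _ = contradiction y≡z y≢z
  ... | tri> _ _ _ | tri> _ _ _ | tri≈ _ y≡z _ = contradiction y≡z y≢z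
  ... | tri< x<y _ _ | tri< x<z _ _ | tri< y<z _ _ = (x , y , z) , (x<y , y<z) , SameSet-refl
  ... | tri< x<y _ _ | tri< x<z _ _ | tri> _ _ z<y = (x , z , y) , (x<z , z<y) , swap₂₃ SameSet-refl
  ... | tri< x<y _ _ | tri> _ _ z<x | _            = (z , x , y) , (z<x , x<y) , swap₂₃ (swap₁₂ SameSet-refl)
  ... | tri> _ _ y<x | tri< x<z _ _ | _            = (y , x , z) , (y<x , x<z) , swap₁₂ SameSet-refl
  ... | tri> _ _ y<x | tri> _ _ z<x | tri< y<z _ _ = (y , z , x) , (y<z , z<x) , swap₁₂ (swap₂₃ SameSet-refl)
  ... | tri> _ _ y<x | tri> _ _ z<x | tri> _ _ z<y = (z , y , x) , (z<y , y<x) , swap₁₂ (swap₂₃ (swap₁₂ SameSet-refl))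

allTriples : ∀ v → List (Triple v)
allTriples v = cartesianProduct (allFin v) (cartesianProduct (allFin v) (allFin v))

∈-allTriples : ∀ {v} (t : Triple v) → t ∈ allTriples v
∈-allTriples (x , y , z) = ∈-cartesianProduct⁺ (∈-allFin x) (∈-cartesianProduct⁺ (∈-allFin y) (∈-allFin z))

allTriples-unique : ∀ v → Unique (allTriples v)
allTriples-unique v = Unique.cartesianProduct⁺ (Unique.allFin⁺ v) (Unique.cartesianProduct⁺ (Unique.allFin⁺ v) (Unique.allFin⁺ v))

fromDec : ∀ {v} {P : Triple v → Set} → (∀ t → Dec (P t)) → Graph3 v
fromDec {v} {P} P? = record
  { edges      = filter PI? (allTriples v)
  ; increasing = All.map proj₁ (all-filter PI? (allTriples v))
  ; distinct   = Unique.filter⁺ PI? (allTriples-unique v)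
  }
  where
  PI? : ∀ t → Dec (Increasing t × P t)
  PI? t = Increasing? t ×-dec P? t

does⇒ : ∀ {P : Set} (d : Dec P) → T (does d) → P
does⇒ (yes p) _ = p

∧-elim : ∀ {x y} → T (x ∧ y) → T x × T y
∧-elim = Equivalence.to T-∧

¬T⇒false : ∀ {b} → ¬ T b → b ≡ false
¬T⇒false {true}  ¬t = contradiction tt ¬t
¬T⇒false {false} _  = refl

-- The order of the first two vertices in an edge of the pattern that meets a cell twice.
before : Bool → Bool → Bool → Bool → Bool
before false _     true  _     = true
before true  _     false _     = false
before false false false true  = true
before true  false true  true  = true
before _     _     _     _     = false

before-irrefl : ∀ s t → ¬ T (before s t s t)
before-irrefl false false ()
before-irrefl false true  ()
before-irrefl true  false ()
before-irrefl true  true  ()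

before-asym : ∀ s t s′ t′ → T (before s t s′ t′) → ¬ T (before s′ t′ s t)
before-asym false _     true  _     _ ()
before-asym false false false true  _ ()
before-asym true  false true  true  _ ()

-- Keeps only those consequences of `role` that distinguish the three vertices and fix their order;
-- which third vertices a pair admits is forgotten.
data RoleView (n : ℕ) : Color → Color → Color → Set where
  hub  : ∀ {i s t j s′ t′} → i ℕ.< n → j ℕ.< i → RoleView n base (cell i s t) (cell j s′ t′)
  pair : ∀ {i s t s′ t′ j σ τ} → i ℕ.< n → j ℕ.< n → i ≢ j → T (before s t s′ t′) →
         RoleView n (cell i s t) (cell i s′ t′) (cell j σ τ)

module _ (n : ℕ) .{{_ : ℕ.NonZero n}} (2≤n : 2 ℕ.≤ n) where

  next≢ : ∀ {i} → i ℕ.< n → i ≢ suc i % n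
  next≢ {i} i<n with ℕₚ.m≤n⇒m<n∨m≡n i<n
  ... | inj₁ 1+i<n = λ eq → ℕₚ.1+n≢n (sym (trans eq (m<n⇒m%n≡m 1+i<n)))
  ... | inj₂ refl  = λ eq → ℕₚ.<-irrefl (sym (trans eq (n%n≡0 n))) (ℕ.s≤s⁻¹ 2≤n)

  third-view : ∀ {i} → i ℕ.< n → ∀ s t s′ t′ j σ → T (third n (suc i % n) i s t s′ t′ j σ) →
    j ℕ.< n × i ≢ j × T (before s t s′ t′)
  third-view {i} i<n false t true t′ j σ p =
    does⇒ (j ℕ.<? n) (proj₁ (∧-elim {does (j ℕ.<? n)} p)) , i≢j (proj₂ (∧-elim {does (j ℕ.<? n)} p)) , tt
    where
    i≢j : T (not (does (j ℕ.≟ i))) → i ≢ j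
    i≢j q refl = subst (T ∘ not) (dec-true (i ℕ.≟ i) refl) q
  third-view {i} i<n false false false true j σ p with does⇒ (j ℕ.≟ suc i % n) (proj₁ (∧-elim {does (j ℕ.≟ suc i % n)} p))
  ... | refl = m%n<n (suc i) n , next≢ i<n , tt
  third-view {i} i<n true false true true j σ p with does⇒ (j ℕ.≟ suc i % n) (proj₁ (∧-elim {does (j ℕ.≟ suc i % n)} p))
  ... | refl = m%n<n (suc i) n , next≢ i<n , tt

  role-view : ∀ α β γ → T (role n α β γ) → RoleView n α β γ
  role-view base (cell i s t) (cell j _ _) p =
    hub (does⇒ (i ℕ.<? n) (proj₁ (∧-elim {does (i ℕ.<? n)} p))) (does⇒ (j ℕ.<? i) (proj₂ (∧-elim {does (i ℕ.<? n)} p)))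
  role-view (cell i s t) (cell i′ s′ t′) (cell j σ τ) p with ∧-elim {does (i ℕ.<? n)} p
  ... | p₁ , p′ with ∧-elim {does (i′ ℕ.≟ i)} p′
  ...   | p₂ , p₃ with does⇒ (i′ ℕ.≟ i) p₂ | does⇒ (i ℕ.<? n) p₁
  ...     | refl | i<n with third-view i<n s t s′ t′ j σ p₃
  ...       | j<n , i≢j , b = pair i<n j<n i≢j b

module _ {n : ℕ} where

  view-≢₁₂ : ∀ {α β γ} → RoleView n α β γ → α ≢ β
  view-≢₁₂ (hub _ _) ()
  view-≢₁₂ (pair {s = s} {t} _ _ _ b) refl = before-irrefl s t b

  view-≢₁₃ : ∀ {α β γ} → RoleView n α β γ → α ≢ γ
  view-≢₁₃ (hub _ _) ()
  view-≢₁₃ (pair _ _ i≢j _) refl = i≢j refl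

  view-≢₂₃ : ∀ {α β γ} → RoleView n α β γ → β ≢ γ
  view-≢₂₃ (hub _ j<i) refl = ℕₚ.<-irrefl refl j<i
  view-≢₂₃ (pair _ _ i≢j _) refl = i≢j refl

  -- Only one order of a set can have a role. With `base` the order is `base` first, then decreasing
  -- index; otherwise the cell met twice comes first and `before` orders its two vertices. So
  -- different triples in `roles` give different edges of the blow-up.
  view-rigid : ∀ {v} (χ : Fin v → Color) {x y z x′ y′ z′} → RoleView n (χ x) (χ y) (χ z) → RoleView n (χ x′) (χ y′) (χ z′) →
    SameSet (x , y , z) (x′ , y′ , z′) → (x , y , z) ≡ (x′ , y′ , z′)
  view-rigid χ p q (inj₁ (refl , refl , refl)) = refl
  view-rigid χ p q (inj₂ (inj₁ (refl , refl , refl))) = contradiction q (132-no p)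
    where
    132-no : ∀ {α β γ} → RoleView n α β γ → ¬ RoleView n α γ β
    132-no (hub _ j<i) (hub _ i<j) = ℕₚ.<-asym j<i i<j
    132-no (pair _ _ i≢j _) (pair _ _ _ _) = i≢j refl
  view-rigid χ p q (inj₂ (inj₂ (inj₁ (refl , refl , refl)))) = contradiction q (213-no p)
    where
    213-no : ∀ {α β γ} → RoleView n α β γ → ¬ RoleView n β α γ
    213-no (pair {s = s} {t} {s′} {t′} _ _ _ b) (pair _ _ _ b′) = before-asym s t s′ t′ b b′
  view-rigid χ p q (inj₂ (inj₂ (inj₂ (inj₁ (refl , refl , refl))))) = contradiction p (231-no q)
    where
    231-no : ∀ {α β γ} → RoleView n α β γ → ¬ RoleView n β γ α
    231-no (pair _ _ i≢j _) (pair _ _ _ _) = i≢j refl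
  view-rigid χ p q (inj₂ (inj₂ (inj₂ (inj₂ (inj₁ (refl , refl , refl)))))) = contradiction q (231-no p)
    where
    231-no : ∀ {α β γ} → RoleView n α β γ → ¬ RoleView n β γ α
    231-no (pair _ _ i≢j _) (pair _ _ _ _) = i≢j refl
  view-rigid χ p q (inj₂ (inj₂ (inj₂ (inj₂ (inj₂ (refl , refl , refl)))))) = contradiction q (321-no p)
    where
    321-no : ∀ {α β γ} → RoleView n α β γ → ¬ RoleView n γ β α
    321-no (pair _ _ i≢j _) (pair _ _ _ _) = i≢j refl

-- Colourable graphs

module _ (n : ℕ) .{{_ : ℕ.NonZero n}} where

  HasRole : ∀ {v} → (Fin v → Color) → Triple v → Set
  HasRole χ (x , y , z) = T (role n (χ x) (χ y) (χ z))

  hasRole? : ∀ {v} (χ : Fin v → Color) t → Dec (HasRole χ t)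
  hasRole? χ (x , y , z) = T? (role n (χ x) (χ y) (χ z))

  roles : ∀ {v} → (Fin v → Color) → List (Triple v)
  roles {v} χ = filter (hasRole? χ) (allTriples v)

  -- A homomorphism to the pattern. It goes through `roles` and `SameSet` because edges are stored
  -- in increasing order, which need not be the order that `role` expects.
  Colourable : ∀ {v} → Graph3 v → Set
  Colourable {v} G = ∃[ χ ] All (λ t → Any (SameSet t) (roles χ)) (edges G)

  ∈-roles : ∀ {v} (χ : Fin v → Color) {t} → HasRole χ t → t ∈ roles χ
  ∈-roles χ {t} p = ∈-filter⁺ (hasRole? χ) (∈-allTriples t) p

  Colourable-⊆ : ∀ {v w} (H : Graph3 v) (G : Graph3 w) → Contains H G → Colourable H → Colourable G
  Colourable-⊆ H G (f , _ , fG) (χ , χH) = χ ∘ f , All.map pull fG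
    where
    back : ∀ {a b c p q r} → SameSet (f a , f b , f c) (p , q , r) → HasRole χ (p , q , r) → Any (SameSet (a , b , c)) (roles (χ ∘ f))
    back (inj₁ (refl , refl , refl)) h = lose (∈-roles (χ ∘ f) h) (inj₁ (refl , refl , refl))
    back (inj₂ (inj₁ (refl , refl , refl))) h = lose (∈-roles (χ ∘ f) h) (inj₂ (inj₁ (refl , refl , refl)))
    back (inj₂ (inj₂ (inj₁ (refl , refl , refl)))) h = lose (∈-roles (χ ∘ f) h) (inj₂ (inj₂ (inj₁ (refl , refl , refl))))
    back (inj₂ (inj₂ (inj₂ (inj₁ (refl , refl , refl))))) h = lose (∈-roles (χ ∘ f) h) (inj₂ (inj₂ (inj₂ (inj₁ (refl , refl , refl)))))
    back (inj₂ (inj₂ (inj₂ (inj₂ (inj₁ (refl , refl , refl)))))) h = lose (∈-roles (χ ∘ f) h) (inj₂ (inj₂ (inj₂ (inj₂ (inj₁ (refl , refl , refl))))))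
    back (inj₂ (inj₂ (inj₂ (inj₂ (inj₂ (refl , refl , refl)))))) h = lose (∈-roles (χ ∘ f) h) (inj₂ (inj₂ (inj₂ (inj₂ (inj₂ (refl , refl , refl))))))
    pull : ∀ {t} → HasEdge H (f (proj₁ t)) (f (proj₁ (proj₂ t))) (f (proj₂ (proj₂ t))) → Any (SameSet t) (roles (χ ∘ f))
    pull h with find h
    ... | e , e∈H , fe with find (All.lookup χH e∈H)
    ...   | ρ , ρ∈ , eρ = back (SameSet-trans fe eρ) (proj₂ (∈-filter⁻ (hasRole? χ) {xs = allTriples _} ρ∈))

  Colourable-size : ∀ {v} (H : Graph3 v) ((χ , _) : Colourable H) → ∣ H ∣ₑ ℕ.≤ length (roles χ)
  Colourable-size H (χ , χH) = ≤-by-matching (distinct H) (increasing H) χH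
    (λ i i′ q q′ → increasing-unique i i′ (SameSet-trans q (SameSet-sym q′)))

  patternGraph : ∀ {v} → (Fin v → Color) → Graph3 v
  patternGraph χ = fromDec (λ t → any? (SameSet? t) (roles χ))

  patternGraph-colourable : ∀ {v} (χ : Fin v → Color) → Colourable (patternGraph χ)
  patternGraph-colourable {v} χ = χ , All.map proj₂ (all-filter (λ t → Increasing? t ×-dec any? (SameSet? t) (roles χ)) (allTriples v))

  -- The three colours of a triple with a role are distinct, hence so are its vertices, and it can
  -- be sorted into an edge. Rigidity makes this assignment injective.
  patternGraph-size : ∀ {v} (χ : Fin v → Color) → 2 ℕ.≤ n → length (roles χ) ℕ.≤ ∣ patternGraph χ ∣ₑ
  patternGraph-size {v} χ 2≤n = ≤-by-matching (Unique.filter⁺ (hasRole? χ) (allTriples-unique v)) (all-filter (hasRole? χ) (allTriples v))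
      (All.tabulate present) (λ p p′ q q′ → view-rigid χ (view p) (view p′) (SameSet-trans q (SameSet-sym q′)))
    where
    view : ∀ {t} → HasRole χ t → RoleView n (χ (proj₁ t)) (χ (proj₁ (proj₂ t))) (χ (proj₂ (proj₂ t)))
    view {x , y , z} = role-view n 2≤n (χ x) (χ y) (χ z)
    present : ∀ {ρ} → ρ ∈ roles χ → Any (SameSet ρ) (edges (patternGraph χ))
    present {ρ} ρ∈ with view {ρ} (proj₂ (∈-filter⁻ (hasRole? χ) {xs = allTriples v} ρ∈))
    ... | w with sort (λ e → view-≢₁₂ w (cong χ e)) (λ e → view-≢₁₃ w (cong χ e)) (λ e → view-≢₂₃ w (cong χ e))
    ...   | t , inc , ρt = lose (∈-filter⁺ (λ t → Increasing? t ×-dec any? (SameSet? t) (roles χ)) (∈-allTriples t) (inc , lose ρ∈ (SameSet-sym ρt))) ρt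

-- Counting edges of the pattern

sumL-map : ∀ {A B : Set} (h : A → B) xs g → sumL (map h xs) g ≡ sumL xs (g ∘ h)
sumL-map h []       g = refl
sumL-map h (x ∷ xs) g = cong (λ s → g (h x) + s) (sumL-map h xs g)

sumL-× : ∀ {A B : Set} (xs : List A) (ys : List B) g → sumL (cartesianProduct xs ys) g ≡ sumL xs (λ x → sumL ys (λ y → g (x , y)))
sumL-× []       ys g = refl
sumL-× (x ∷ xs) ys g = trans (sumL-++ (map (x ,_) ys) (cartesianProduct xs ys) g)
  (cong₂ _+_ (sumL-map (x ,_) ys g) (sumL-× xs ys g))

length-filter : ∀ {A : Set} {P : A → Set} (P? : ∀ x → Dec (P x)) xs → + length (filter P? xs) ≡ sumL xs (λ x → ⟦ does (P? x) ⟧)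
length-filter P? []       = refl
length-filter P? (x ∷ xs) with does (P? x)
... | true  = cong (λ s → 1ℤ + s) (length-filter P? xs)
... | false = trans (length-filter P? xs) (sym (+-identityˡ (sumL xs (λ x → ⟦ does (P? x) ⟧))))

module _ (n : ℕ) .{{_ : ℕ.NonZero n}} {v : ℕ} (χ : Fin v → Color) where

  length-roles : + length (roles n χ) ≡
    sumL (allFin v) (λ x → sumL (allFin v) (λ y → sumL (allFin v) (λ z → ⟦ role n (χ x) (χ y) (χ z) ⟧)))
  length-roles = trans (length-filter (hasRole? n χ) (allTriples v))
    (trans (sumL-× (allFin v) (cartesianProduct (allFin v) (allFin v)) (λ t → ⟦ does (hasRole? n χ t) ⟧))
      (sumL-cong (allFin v) (λ x → sumL-× (allFin v) (allFin v) (λ p → ⟦ does (hasRole? n χ (x , p)) ⟧))))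

module _ (n : ℕ) .{{_ : ℕ.NonZero n}} (3≤n : 3 ℕ.≤ n) where

  private
    view : ∀ α β γ → T (role n α β γ) → RoleView n α β γ
    view = role-view n (ℕₚ.<⇒≤ 3≤n)
    far : ∀ {b} → ¬ T b → ⟦ b ⟧ ≡ 0ℤ
    far ¬t = cong ⟦_⟧ (¬T⇒false ¬t)

  role-far₃ : ∀ α β {i s t} → n ℕ.≤ i → ⟦ role n α β (cell i s t) ⟧ ≡ 0ℤ
  role-far₃ α β {i} {s} {t} n≤i = far (λ p → absurd (view α β (cell i s t) p))
    where
    absurd : ∀ {α β} → ¬ RoleView n α β (cell i s t)
    absurd (hub i<n j<i)   = ℕₚ.<-irrefl refl (ℕₚ.<-≤-trans (ℕₚ.<-trans j<i i<n) n≤i)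
    absurd (pair _ j<n _ _) = ℕₚ.<-irrefl refl (ℕₚ.<-≤-trans j<n n≤i)

  role-far₂ : ∀ α {i s t} γ → n ℕ.≤ i → ⟦ role n α (cell i s t) γ ⟧ ≡ 0ℤ
  role-far₂ α {i} {s} {t} γ n≤i = far (λ p → absurd (view α (cell i s t) γ p))
    where
    absurd : ∀ {α γ} → ¬ RoleView n α (cell i s t) γ
    absurd (hub i<n _)      = ℕₚ.<-irrefl refl (ℕₚ.<-≤-trans i<n n≤i)
    absurd (pair i<n _ _ _) = ℕₚ.<-irrefl refl (ℕₚ.<-≤-trans i<n n≤i)

  role-far₁ : ∀ {i s t} β γ → n ℕ.≤ i → ⟦ role n (cell i s t) β γ ⟧ ≡ 0ℤ
  role-far₁ {i} {s} {t} β γ n≤i = far (λ p → absurd (view (cell i s t) β γ p))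
    where
    absurd : ∀ {β γ} → ¬ RoleView n (cell i s t) β γ
    absurd (pair i<n _ _ _) = ℕₚ.<-irrefl refl (ℕₚ.<-≤-trans i<n n≤i)

  module _ {v : ℕ} (χ : Fin v → Color) where

    private
      L : List Color
      L = map χ (allFin v)
      b : ℤ
      b = countBase L
      c : Weights
      c = countCell L
      A = allFin v

    -- `sumL-weighted` is applied to one vertex at a time, the third first; in each position a role
    -- excludes cells from `n` on.
    roles-weighted : + length (roles n χ) ≡ role-sum n b c
    roles-weighted = trans (length-roles n χ)
      (trans (sumL-cong A (λ x → trans (sumL-cong A (λ y → inner (χ x) (χ y))) (middle (χ x)))) outer)
      where
      w₃ : Color → Color → ℤ
      w₃ α β = weighted n b c (λ γ → ⟦ role n α β γ ⟧)
      w₂ : Color → ℤ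
      w₂ α = weighted n b c (w₃ α)
      inner : ∀ α β → sumL A (λ z → ⟦ role n α β (χ z) ⟧) ≡ w₃ α β
      inner α β = trans (sym (sumL-map χ A (λ γ → ⟦ role n α β γ ⟧)))
        (sumL-weighted n L (λ γ → ⟦ role n α β γ ⟧) (λ i s t → role-far₃ α β {i} {s} {t}))
      middle : ∀ α → sumL A (λ y → w₃ α (χ y)) ≡ w₂ α
      middle α = trans (sym (sumL-map χ A (w₃ α)))
        (sumL-weighted n L (w₃ α) (λ i s t n≤i → weighted-zero n b c (λ γ → ⟦ role n α (cell i s t) γ ⟧) (λ γ → role-far₂ α {i} {s} {t} γ n≤i)))
      outer : sumL A (λ x → w₂ (χ x)) ≡ role-sum n b c
      outer = trans (sym (sumL-map χ A w₂))
        (sumL-weighted n L w₂ (λ i s t n≤i → weighted-zero n b c (w₃ (cell i s t))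
          (λ β → weighted-zero n b c (λ γ → ⟦ role n (cell i s t) β γ ⟧) (λ γ → role-far₁ {i} {s} {t} β γ n≤i))))

    -- Equality can fail: vertices coloured by cells from `n` on count in `v` but carry no weight.
    total-weight : ∑ n (λ i → quad (c i)) + b ≤ + v
    total-weight = subst₂ _≤_ (sym lhs) (trans (sumL-const1 L) (cong +_ (trans (length-map χ A) (length-tabulate id))))
      (sumL-mono L one-≤)
      where
      one : Color → ℤ
      one base         = 1ℤ
      one (cell i _ _) = ⟦ does (i ℕ.<? n) ⟧
      ⟦⟧≤1 : ∀ x → ⟦ x ⟧ ≤ 1ℤ
      ⟦⟧≤1 true  = ≤-refl
      ⟦⟧≤1 false = nn 1
      one-≤ : ∀ α → one α ≤ 1ℤ
      one-≤ base         = ≤-refl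
      one-≤ (cell i _ _) = ⟦⟧≤1 (does (i ℕ.<? n))
      far-one : ∀ i s t → n ℕ.≤ i → one (cell i s t) ≡ 0ℤ
      far-one i s t n≤i = cong ⟦_⟧ (dec-false (i ℕ.<? n) (ℕₚ.≤⇒≯ n≤i))
      lhs : ∑ n (λ i → quad (c i)) + b ≡ sumL L one
      lhs = sym (trans (sumL-weighted n L one far-one) (trans (cong₂ _+_ (*-identityʳ b)
        (∑-cong< n (λ i i<n → quad-cong (λ s t → trans (cong (λ x → c i s t * ⟦ x ⟧) (dec-true (i ℕ.<? n) i<n)) (*-identityʳ (c i s t))))))
        (+-comm b (∑ n (λ i → quad (c i))))))

    roles-upper : + length (roles n χ) * + 432 * + n ≤ cube (+ v) * (+ n * + 32 + + 9)
    roles-upper = subst (λ e → e * + 432 * + n ≤ cube (+ v) * (+ n * + 32 + + 9)) (sym roles-weighted)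
      (≤-trans (role-sum-bound n 3≤n b b≥0 c c≥0)
        (*-monoʳ-≤-nonNeg (+ n * + 32 + + 9) {{nonNegative (nn n ⊗ nn 32 ⊕ nn 9)}} (cube-mono s≥0 total-weight)))
      where
      b≥0 : Nonneg b
      b≥0 = sumL-nonneg L (λ α → ⟦⟧-nonneg (isBase α))
      c≥0 : ∀ i s t → Nonneg (c i s t)
      c≥0 = countCell-nonneg L
      s≥0 : Nonneg (∑ n (λ i → quad (c i)) + b)
      s≥0 = ∑-nonneg n (λ i → (c≥0 i false false ⊕ c≥0 i false true) ⊕ (c≥0 i true false ⊕ c≥0 i true true)) ⊕ b≥0
      cube-mono : ∀ {x y} → Nonneg x → x ≤ y → cube x ≤ cube y
      cube-mono {x} {y} px x≤y = ≤-by _ (eq x y) (gap x≤y ⊗ (sq y ⊕ ≤-trans px x≤y ⊗ px ⊕ sq x))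
        where
        eq : ∀ x y → y * y * y - x * x * x ≡ (y - x) * (y * y + y * x + x * x)
        eq = solve-∀

-- Blow-ups of the pattern

cells : ℕ → List Color
cells zero    = []
cells (suc n) = cell n false false ∷ cell n false true ∷ cell n true false ∷ cell n true true ∷ cells n

blowUp : (n b k : ℕ) → List Color
blowUp n b zero    = []
blowUp n b (suc k) = (cells n ++ replicate b base) ++ blowUp n b k

length-cells : ∀ n → length (cells n) ≡ 4 ℕ.* n
length-cells zero    = refl
length-cells (suc n) = trans (cong (4 ℕ.+_) (length-cells n)) (sym (ℕₚ.*-suc 4 n))

length-blowUp : ∀ n b k → length (blowUp n b k) ≡ k ℕ.* (4 ℕ.* n ℕ.+ b)
length-blowUp n b zero    = refl
length-blowUp n b (suc k) = trans (length-++ (cells n ++ replicate b base)) (cong₂ ℕ._+_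
  (trans (length-++ (cells n)) (cong₂ ℕ._+_ (length-cells n) (length-replicate b))) (length-blowUp n b k))

sumL-cells : ∀ n g → sumL (cells n) g ≡ ∑ n (λ i → quad (λ s t → g (cell i s t)))
sumL-cells zero    g = refl
sumL-cells (suc n) g = trans (cong (λ r → g (cell n false false) + (g (cell n false true) + (g (cell n true false) + (g (cell n true true) + r)))) (sumL-cells n g))
  (eq (g (cell n false false)) (g (cell n false true)) (g (cell n true false)) (g (cell n true true)) (∑ n (λ i → quad (λ s t → g (cell i s t)))))
  where
  eq : ∀ a b c d r → a + (b + (c + (d + r))) ≡ r + (a + b + (c + d))
  eq = solve-∀

sumL-replicate : ∀ b α (g : Color → ℤ) → sumL (replicate b α) g ≡ + b * g α
sumL-replicate zero    α g = sym (*-zeroˡ (g α))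
sumL-replicate (suc b) α g = trans (cong (λ s → g α + s) (sumL-replicate b α g)) (eq (g α) (+ b))
  where
  eq : ∀ x b → x + b * x ≡ (1ℤ + b) * x
  eq = solve-∀

sumL-blowUp : ∀ n b k g → sumL (blowUp n b k) g ≡ weighted n (+ k * + b) (λ _ _ _ → + k) g
sumL-blowUp n b k g = trans (copies k) (trans (eq (+ k) (∑ n (λ i → quad (λ s t → g (cell i s t)))) (+ b) (g base))
    (cong (λ s → + k * + b * g base + s) (sym (trans (∑-cong n (λ i → quad-* (+ k) (λ s t → g (cell i s t))))
      (∑-* n (+ k) (λ i → quad (λ s t → g (cell i s t))))))))
  where
  eq : ∀ k q b x → k * (q + b * x) ≡ k * b * x + k * q
  eq = solve-∀
  eq′ : ∀ k x → x + k * x ≡ (1ℤ + k) * x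
  eq′ = solve-∀
  copies : ∀ k → sumL (blowUp n b k) g ≡ + k * (∑ n (λ i → quad (λ s t → g (cell i s t))) + + b * g base)
  copies zero    = sym (*-zeroˡ (∑ n (λ i → quad (λ s t → g (cell i s t))) + + b * g base))
  copies (suc k) = trans (sumL-++ (cells n ++ replicate b base) (blowUp n b k) g)
    (trans (cong₂ _+_ (trans (sumL-++ (cells n) (replicate b base) g) (cong₂ _+_ (sumL-cells n g) (sumL-replicate b base g))) (copies k))
      (eq′ (+ k) (∑ n (λ i → quad (λ s t → g (cell i s t))) + + b * g base)))

-- The default gives the vertices left over by the blow-up the colour `base`. They can only add
-- edges, so the lower bounds persist.
colorAt : List Color → ℕ → Color
colorAt []       _       = base
colorAt (α ∷ _)  zero    = α
colorAt (_ ∷ αs) (suc i) = colorAt αs i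

sumL-colorAt : ∀ {A : Set} {v} (αs : List Color) (f : Fin v → A) (χ : A → Color) → (∀ i → χ (f i) ≡ colorAt αs (Fin.toℕ i)) →
  length αs ℕ.≤ v → ∀ {g} → (∀ α → Nonneg (g α)) → sumL αs g ≤ sumL (tabulate f) (g ∘ χ)
sumL-colorAt []       f χ eq _ p = sumL-nonneg (tabulate f) (λ x → p (χ x))
sumL-colorAt (α ∷ αs) f χ eq (ℕ.s≤s l) {g} p =
  +-mono-≤ (≤-reflexive (cong g (sym (eq Fin.zero)))) (sumL-colorAt αs (f ∘ Fin.suc) χ (λ i → eq (Fin.suc i)) l p)

weighted-nonneg : ∀ n {b c g} → Nonneg b → (∀ i s t → Nonneg (c i s t)) → (∀ α → Nonneg (g α)) → Nonneg (weighted n b c g)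
weighted-nonneg n {b} {c} {g} pb pc pg = pb ⊗ pg base ⊕ ∑-nonneg n (λ i → (q i false false ⊕ q i false true) ⊕ (q i true false ⊕ q i true true))
  where
  q : ∀ i s t → Nonneg (c i s t * g (cell i s t))
  q i s t = pc i s t ⊗ pg (cell i s t)

module _ (n : ℕ) .{{_ : ℕ.NonZero n}} (b k v : ℕ) (fits : k ℕ.* (4 ℕ.* n ℕ.+ b) ℕ.≤ v) where

  private
    C : List Color
    C = blowUp n b k

  blowUpColor : Fin v → Color
  blowUpColor i = colorAt C (Fin.toℕ i)

  private
    K : ℤ
    K = + k * + b
    c : Weights
    c _ _ _ = + k
    A = allFin v
    K≥0 : Nonneg K
    K≥0 = nn k ⊗ nn b
    w₃ : Color → Color → ℤ
    w₃ α β = weighted n K c (λ γ → ⟦ role n α β γ ⟧)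
    w₂ : Color → ℤ
    w₂ α = weighted n K c (w₃ α)
    w₃≥0 : ∀ α β → Nonneg (w₃ α β)
    w₃≥0 α β = weighted-nonneg n K≥0 (λ _ _ _ → nn k) (λ γ → ⟦⟧-nonneg (role n α β γ))
    w₂≥0 : ∀ α → Nonneg (w₂ α)
    w₂≥0 α = weighted-nonneg n K≥0 (λ _ _ _ → nn k) (w₃≥0 α)
    lower : ∀ g → (∀ α → Nonneg (g α)) → weighted n K c g ≤ sumL A (g ∘ blowUpColor)
    lower g p = subst (_≤ sumL A (g ∘ blowUpColor)) (sumL-blowUp n b k g)
      (sumL-colorAt C id blowUpColor (λ _ → refl) (subst (ℕ._≤ v) (sym (length-blowUp n b k)) fits) p)

  roles-lower : role-sum n K c ≤ + length (roles n blowUpColor)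
  roles-lower = subst (role-sum n K c ≤_) (sym (length-roles n blowUpColor))
    (≤-trans (lower w₂ w₂≥0) (sumL-mono A (λ x → ≤-trans (lower (w₃ (blowUpColor x)) (w₃≥0 (blowUpColor x)))
      (sumL-mono A (λ y → lower (λ γ → ⟦ role n (blowUpColor x) (blowUpColor y) γ ⟧) (λ γ → ⟦⟧-nonneg (role n (blowUpColor x) (blowUpColor y) γ)))))))

role-sum-const : (n : ℕ) .{{_ : ℕ.NonZero n}} → ∀ b k → role-sum n b (λ _ _ _ → k) * + 2
  ≡ b * (+ n * + n - + n) * (k * k * + 16) + (+ n * (+ n - 1ℤ) * + 32 + + n * + 8) * (k * k * k)
role-sum-const n b k = trans (cong (_* + 2) (trans R.role-sum-eval (cong (λ g → b * ∑ n (λ i → u * ∑ i (λ _ → u)) + g)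
    (trans (∑-const n ((k + k) * (k + k) * (∑ n (λ _ → u) - u) + (k * k * (k + k) + k * k * (k + k))))
      (cong (λ s → + n * ((k + k) * (k + k) * (s - u) + (k * k * (k + k) + k * k * (k + k)))) (∑-const n u))))))
  (trans (eq₁ b (∑ n (λ i → u * ∑ i (λ _ → u))) _) (trans (cong (λ p → b * p + + n * ((k + k) * (k + k) * (+ n * u - u) + (k * k * (k + k) + k * k * (k + k))) * + 2)
    (trans (∑-pairs n (λ _ → u)) (cong₂ _-_ (cong₂ _*_ (∑-const n u) (∑-const n u)) (∑-const n (u * u)))))
    (eq₂ b (+ n) k)))
  where
  module R = RoleSum n b (λ _ _ _ → k)
  u : ℤ
  u = k + k + (k + k)
  eq₁ : ∀ b p g → (b * p + g) * + 2 ≡ b * (p * + 2) + g * + 2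
  eq₁ = solve-∀
  eq₂ : ∀ b n k → let u = k + k + (k + k) in
    b * (n * u * (n * u) - n * (u * u)) + n * ((k + k) * (k + k) * (n * u - u) + (k * k * (k + k) + k * k * (k + k))) * + 2
    ≡ b * (n * n - n) * (k * k * + 16) + (n * (n - 1ℤ) * + 32 + n * + 8) * (k * k * k)
  eq₂ = solve-∀

-- The family

NotColourable : (n : ℕ) .{{_ : ℕ.NonZero n}} → Family
NotColourable n k G = ¬ Colourable n G

contains-self : ∀ {v} (H : Graph3 v) → Contains H H
contains-self H = id , id , All.tabulate (λ {t} t∈ → lose t∈ SameSet-refl)

complete₆ : Graph3 6
complete₆ = fromDec {P = λ _ → T true} (λ _ → yes tt)

module _ (n : ℕ) .{{_ : ℕ.NonZero n}} (3≤n : 3 ℕ.≤ n) where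

  colourable-upper : ∀ {v} (H : Graph3 v) → Colourable n H → + ∣ H ∣ₑ * + 432 * + n ≤ cube (+ v) * (+ n * + 32 + + 9)
  colourable-upper H χH = ≤-trans (*-monoʳ-≤-nonNeg (+ n) (*-monoʳ-≤-nonNeg (+ 432) (+≤+ (Colourable-size n H χH)))) (roles-upper n 3≤n (proj₁ χH))

  -- An uncolourable graph would contain a member of the family, namely itself. This yields only the
  -- double negation of colourability, which suffices because the inequality is decidable.
  free-upper : ∀ {v} (H : Graph3 v) → Free (NotColourable n) H → + ∣ H ∣ₑ * + 432 * + n ≤ cube (+ v) * (+ n * + 32 + + 9)
  free-upper H free = decidable-stable (_ ≤? _) (λ ¬bound → free _ H (λ χH → ¬bound (colourable-upper H χH)) (contains-self H))

  -- A colourable graph on 6 vertices has at most `36 (4/9 + 1/(8n)) ≤ 17.5` edges, fewer than 20.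
  -- On 5 vertices the same count would not exclude `n = 3`.
  complete₆-uncolourable : ¬ Colourable n complete₆
  complete₆-uncolourable χ = absurd (≤-by _ (eq (+ n)) (gap (colourable-upper complete₆ χ) ⊕ gap (+≤+ 3≤n) ⊗ nn 1728))
    where
    eq : ∀ n → - (+ 1) - + 3239 ≡ + 216 * (n * + 32 + + 9) - + 8640 * n + (n - + 3) * + 1728
    eq = solve-∀
    absurd : ¬ (+ 3239 ≤ - (+ 1))
    absurd ()

  blowUp-free : ∀ {v} (χ : Fin v → Color) → Free (NotColourable n) (patternGraph n χ)
  blowUp-free χ k G ¬colourable sub = ¬colourable (Colourable-⊆ n (patternGraph n χ) G sub (patternGraph-colourable n χ))

-- Binomial coefficients

open import Data.Nat.Combinatorics using (_C_; nC1≡n; nCk+nC[k+1]≡[n+1]C[k+1])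

private
  pascal : ∀ v k → + (suc v C suc k) ≡ + (v C k) + + (v C suc k)
  pascal v k = cong +_ (sym (nCk+nC[k+1]≡[n+1]C[k+1] v k))

choose₂ : ∀ v → + (v C 2) * + 2 ≡ + v * (+ v - 1ℤ)
choose₂ zero    = refl
choose₂ (suc v) = trans (cong (_* + 2) (trans (pascal v 1) (cong (λ m → + m + + (v C 2)) (nC1≡n v))))
  (trans (eq₁ (+ v) (+ (v C 2))) (trans (cong (λ s → + v * + 2 + s) (choose₂ v)) (eq₂ (+ v))))
  where
  eq₁ : ∀ v c → (v + c) * + 2 ≡ v * + 2 + c * + 2
  eq₁ = solve-∀
  eq₂ : ∀ v → v * + 2 + v * (v - 1ℤ) ≡ (1ℤ + v) * (1ℤ + v - 1ℤ)
  eq₂ = solve-∀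

choose₃ : ∀ v → + (v C 3) * + 6 ≡ + v * (+ v - 1ℤ) * (+ v - + 2)
choose₃ zero    = refl
choose₃ (suc v) = trans (cong (_* + 6) (pascal v 2))
  (trans (eq₁ (+ (v C 2)) (+ (v C 3))) (trans (cong₂ (λ s t → s * + 3 + t) (choose₂ v) (choose₃ v)) (eq₂ (+ v))))
  where
  eq₁ : ∀ c d → (c + d) * + 6 ≡ c * + 2 * + 3 + d * + 6
  eq₁ = solve-∀
  eq₂ : ∀ v → v * (v - 1ℤ) * + 3 + v * (v - 1ℤ) * (v - + 2) ≡ (1ℤ + v) * (1ℤ + v - 1ℤ) * (1ℤ + v - + 2)
  eq₂ = solve-∀

-- Numerical estimates, with D the denominator of c and n = D + 2 cells

private
  -- Passes from `4/9 + 1/(8n)` relative to `v³/6` to `4/9 + 1/(2D)` relative to `c`, the binomial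
  -- coefficient. The difference of the two fractions pays for replacing `v³` by `v(v - 1)(v - 2)`
  -- once `v ≥ 4D + 4`.
  upper-estimate : ∀ D v e c n .{{_ : Positive n}} → Nonneg D → n ≡ D + + 2 → Nonneg v → D * + 4 + + 4 ≤ v →
    c * + 6 ≡ v * (v - 1ℤ) * (v - + 2) → e * + 432 * n ≤ cube v * (n * + 32 + + 9) →
    e * (D * + 18) ≤ (D * + 8 + + 9) * c
  upper-estimate D v e c n D≥0 n≡ v≥0 v-large c≡ bound = *-cancelʳ-≤-pos _ _ n (≤-by-scaled 23 _
    (trans (eq₁ D e c n) (trans (cong (λ s → (D * + 8 + + 9) * s * n * + 4 - e * + 432 * n * D) c≡)
      (trans (cong (λ m → (D * + 8 + + 9) * (v * (v - 1ℤ) * (v - + 2)) * m * + 4 - e * + 432 * m * D) n≡) (eq₂ D v e))))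
    (gap (subst (λ m → e * + 432 * m ≤ cube v * (m * + 32 + + 9)) n≡ bound) ⊗ D≥0
     ⊕ v≥0 ⊗ (v≥0 ⊗ ((D≥0 ⊗ nn 27 ⊕ nn 72) ⊗ gap v-large ⊕ D≥0 ⊗ D≥0 ⊗ nn 12 ⊕ D≥0 ⊗ nn 96 ⊕ nn 72)
              ⊕ (D≥0 ⊗ D≥0 ⊗ nn 32 ⊕ D≥0 ⊗ nn 100 ⊕ nn 72) ⊗ nn 2)))
    where
    eq₁ : ∀ D e c n → ((D * + 8 + + 9) * c * n - e * (D * + 18) * n) * + 24
      ≡ (D * + 8 + + 9) * (c * + 6) * n * + 4 - e * + 432 * n * D
    eq₁ = solve-∀
    eq₂ : ∀ D v e → let n = D + + 2 in
      (D * + 8 + + 9) * (v * (v - 1ℤ) * (v - + 2)) * n * + 4 - e * + 432 * n * D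
      ≡ (v * v * v * (n * + 32 + + 9) - e * + 432 * n) * D
        + v * (v * ((D * + 27 + + 72) * (v - (D * + 4 + + 4)) + D * D * + 12 + D * + 96 + + 72)
               + (D * D * + 32 + D * + 100 + + 72) * + 2)
    eq₂ = solve-∀

  -- A full blow-up reaches `4/9 + 4/(9s³)`; half of this excess is given up for the vertices that
  -- do not fill a block. The condition on `k` is made for `(k + 1)³(4s³ + 2) ≤ k³(4s³ + 4)`.
  lower-estimate : ∀ s k v e c → Nonneg s → 1ℤ ≤ k → 1ℤ ≤ v → (cube s * + 4 + + 2) * + 4 ≤ k → v ≤ (k + 1ℤ) * (s * + 3) →
    c * + 6 ≡ v * (v - 1ℤ) * (v - + 2) → cube k * (cube s * + 4 + + 4) ≤ e * + 2 →
    (cube s * + 4 + + 2) * c ≤ e * (cube s * + 9)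
  lower-estimate s k v e c s≥0 k≥1 v≥1 k-large v-small c≡ bound = ≤-by-scaled 23 _
      (trans (eq₁ s e c) (trans (cong (λ m → e * (s * s * s) * + 216 - (s * s * s * + 4 + + 2) * m * + 4) c≡) (eq₂ s k v e)))
      (gap bound ⊗ s³ ⊗ nn 108
       ⊕ s³ ⊗ (gap k-large ⊗ (k≥0 ⊗ k≥0 ⊗ nn 3 ⊕ k≥0 ⊗ nn 3 ⊕ nn 1)
               ⊕ (gap k≥1 ⊗ (k≥0 ⊗ k≥0 ⊗ nn 5 ⊕ k≥0 ⊗ nn 2 ⊕ nn 1) ⊕ nn 1)) ⊗ nn 27
       ⊕ (s³ ⊗ nn 4 ⊕ nn 2) ⊗ (gap v-small ⊗ (w ⊗ w ⊕ w ⊗ v≥0 ⊕ v≥0 ⊗ v≥0) ⊕ v≥0 ⊗ (gap v≥1 ⊗ nn 3 ⊕ nn 1)) ⊗ nn 4)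
    where
    k≥0 : Nonneg k
    k≥0 = ≤-trans (nn 1) k≥1
    v≥0 : Nonneg v
    v≥0 = ≤-trans (nn 1) v≥1
    s³ : Nonneg (s * s * s)
    s³ = s≥0 ⊗ s≥0 ⊗ s≥0
    w : Nonneg ((k + 1ℤ) * (s * + 3))
    w = (k≥0 ⊕ nn 1) ⊗ (s≥0 ⊗ nn 3)
    eq₁ : ∀ s e c → (e * (s * s * s * + 9) - (s * s * s * + 4 + + 2) * c) * + 24
      ≡ e * (s * s * s) * + 216 - (s * s * s * + 4 + + 2) * (c * + 6) * + 4
    eq₁ = solve-∀
    eq₂ : ∀ s k v e → let w = (k + 1ℤ) * (s * + 3) in
      e * (s * s * s) * + 216 - (s * s * s * + 4 + + 2) * (v * (v - 1ℤ) * (v - + 2)) * + 4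
      ≡ (e * + 2 - k * k * k * (s * s * s * + 4 + + 4)) * (s * s * s) * + 108
        + s * s * s * ((k - (s * s * s * + 4 + + 2) * + 4) * (k * k * + 3 + k * + 3 + + 1)
                       + ((k - 1ℤ) * (k * k * + 5 + k * + 2 + + 1) + + 1)) * + 27
        + (s * s * s * + 4 + + 2) * ((w - v) * (w * w + w * v + v * v) + v * ((v - 1ℤ) * + 3 + + 1)) * + 4
    eq₂ = solve-∀

-- Parameters of the blow-up and the two bounds on edges

module Density (D n : ℕ) .{{_ : ℕ.NonZero n}} .{{_ : ℕ.NonZero D}} (n≡ : n ≡ D ℕ.+ 2) where

  3≤n : 3 ℕ.≤ n
  3≤n = subst (3 ℕ.≤_) (sym n≡) (ℕₚ.+-monoˡ-≤ 2 (ℕ.>-nonZero⁻¹ D))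

  -- With weight 1 for each of the 4n vertices of the cells and weight b = 2n - 3 for B, every u equals w.
  b s s³ large : ℕ
  b = 2 ℕ.* D ℕ.+ 1
  s = 2 ℕ.* D ℕ.+ 3
  s³ = s ℕ.* s ℕ.* s
  large = (s³ ℕ.* 4 ℕ.+ 2) ℕ.* 4

  -- The number `4n + b = 3s` of vertices in one copy, written as a successor so that division by it
  -- is visibly allowed.
  block : ℕ
  block = suc (6 ℕ.* D ℕ.+ 8)

  n≡ℤ : + n ≡ + D + + 2
  n≡ℤ = cong +_ n≡

  b≡ℤ : + b ≡ + D * + 2 + + 1
  b≡ℤ = cong (_+ 1ℤ) (trans (pos-* 2 D) (*-comm (+ 2) (+ D)))

  s≡ℤ : + s ≡ + D * + 2 + + 3
  s≡ℤ = cong (_+ + 3) (trans (pos-* 2 D) (*-comm (+ 2) (+ D)))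

  cube≡ℤ : + s³ ≡ cube (+ s)
  cube≡ℤ = trans (pos-* (s ℕ.* s) s) (cong (_* + s) (pos-* s s))

  large≡ℤ : + large ≡ (cube (+ s) * + 4 + + 2) * + 4
  large≡ℤ = trans (pos-* (s³ ℕ.* 4 ℕ.+ 2) 4) (cong (λ x → (x + + 2) * + 4) (trans (pos-* s³ 4) (cong (_* + 4) cube≡ℤ)))

  block≡ : 4 ℕ.* n ℕ.+ b ≡ block
  block≡ = +-injective (trans (cong₂ (λ x y → x + y) (trans (pos-* 4 n) (cong (+ 4 *_) n≡ℤ)) b≡ℤ)
      (trans (eq (+ D)) (cong (λ x → 1ℤ + (x + + 8)) (sym (pos-* 6 D)))))
    where
    eq : ∀ D → + 4 * (D + + 2) + (D * + 2 + + 1) ≡ 1ℤ + (+ 6 * D + + 8)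
    eq = solve-∀

  block≡ℤ : + block ≡ + s * + 3
  block≡ℤ = trans (cong (λ x → 1ℤ + (x + + 8)) (pos-* 6 D)) (trans (eq (+ D)) (cong (_* + 3) (sym s≡ℤ)))
    where
    eq : ∀ D → 1ℤ + (+ 6 * D + + 8) ≡ (D * + 2 + + 3) * + 3
    eq = solve-∀

  module _ (v : ℕ) (v-large : large ℕ.* block ℕ.≤ v) where

    private
      k : ℕ
      k = v ℕ./ block
      large≤k : large ℕ.≤ k
      large≤k = subst (ℕ._≤ k) (m*n/n≡m large block) (/-monoˡ-≤ block v-large)
      1≤k : 1 ℕ.≤ k
      1≤k = ℕₚ.≤-trans (ℕₚ.≤-trans (ℕ.s≤s ℕ.z≤n) (ℕₚ.≤-trans (ℕₚ.m≤n+m 2 (s³ ℕ.* 4)) (ℕₚ.m≤m*n (s³ ℕ.* 4 ℕ.+ 2) 4))) large≤k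
      fits : k ℕ.* (4 ℕ.* n ℕ.+ b) ℕ.≤ v
      fits = subst (λ l → k ℕ.* l ℕ.≤ v) (sym block≡) (m/n*n≤m v block)
      1≤v : 1 ℕ.≤ v
      1≤v = ℕₚ.≤-trans 1≤k (ℕₚ.≤-trans (ℕₚ.m≤m*n k block) (m/n*n≤m v block))
      v≤ : + v ≤ (+ k + 1ℤ) * (+ s * + 3)
      v≤ = subst (+ v ≤_) (trans (pos-* (k ℕ.+ 1) block) (cong ((+ k + 1ℤ) *_) block≡ℤ)) (+≤+ (begin
        v                              ≡⟨ m≡m%n+[m/n]*n v block ⟩
        v % block ℕ.+ k ℕ.* block      ≤⟨ ℕₚ.+-monoˡ-≤ (k ℕ.* block) (ℕₚ.<⇒≤ (m%n<n v block)) ⟩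
        block ℕ.+ k ℕ.* block          ≡⟨ cong (ℕ._* block) (ℕₚ.+-comm 1 k) ⟩
        (k ℕ.+ 1) ℕ.* block            ∎))
        where open ℕₚ.≤-Reasoning

    lowerGraph : Graph3 v
    lowerGraph = patternGraph n (blowUpColor n b k v fits)

    lowerGraph-free : Free (NotColourable n) lowerGraph
    lowerGraph-free = blowUp-free n 3≤n (blowUpColor n b k v fits)

    lowerGraph-size : (cube (+ s) * + 4 + + 2) * + (v C 3) ≤ + ∣ lowerGraph ∣ₑ * (cube (+ s) * + 9)
    lowerGraph-size = lower-estimate (+ s) (+ k) (+ v) (+ ∣ lowerGraph ∣ₑ) (+ (v C 3)) (nn s) (+≤+ 1≤k) (+≤+ 1≤v)
      (subst (_≤ + k) large≡ℤ (+≤+ large≤k)) v≤ (choose₃ v)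
      (≤-trans (≤-reflexive (sym (trans (role-sum-const n (+ k * + b) (+ k)) (trans
          (cong₂ (λ m β → + k * β * (m * m - m) * (+ k * + k * + 16) + (m * (m - 1ℤ) * + 32 + m * + 8) * (+ k * + k * + k)) n≡ℤ b≡ℤ)
          (trans (eq (+ k) (+ D)) (cong (λ σ → cube (+ k) * (cube σ * + 4 + + 4)) (sym s≡ℤ)))))))
        (*-monoʳ-≤-nonNeg (+ 2) (≤-trans (roles-lower n b k v fits)
          (+≤+ (patternGraph-size n (blowUpColor n b k v fits) (ℕₚ.<⇒≤ 3≤n))))))
      where
      -- For `k = 1` the total weight is `N = 3s` and `6e = 12s³ + 12`. The excess 12 over `4/9 N³`
      -- is `3/16 w³` with `w = 4`.
      eq : ∀ k D → let n = D + + 2; b = D * + 2 + + 1; s = D * + 2 + + 3 in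
        k * b * (n * n - n) * (k * k * + 16) + (n * (n - 1ℤ) * + 32 + n * + 8) * (k * k * k)
        ≡ k * k * k * (s * s * s * + 4 + + 4)
      eq = solve-∀

  upper-size : ∀ v → 4 ℕ.* D ℕ.+ 4 ℕ.≤ v → (H : Graph3 v) → Free (NotColourable n) H →
    + ∣ H ∣ₑ * (+ D * + 18) ≤ (+ D * + 8 + + 9) * + (v C 3)
  upper-size v v-large H free = upper-estimate (+ D) (+ v) (+ ∣ H ∣ₑ) (+ (v C 3)) (+ n) {{posn n 3≤n}} (nn D) n≡ℤ (nn v)
    (subst (_≤ + v) (cong (_+ + 4) (trans (pos-* 4 D) (*-comm (+ 4) (+ D)))) (+≤+ v-large)) (choose₃ v) (free-upper n 3≤n H free)
    where
    posn : ∀ n → 3 ℕ.≤ n → Positive (+ n)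
    posn (suc _) _ = _

-- Rational bounds

private
  toℚᵘ-/ : ∀ A B → toℚᵘ (+ A / suc B) ℚᵘ.≃ mkℚᵘ (+ A) B
  toℚᵘ-/ A B = ℚₚ.toℚᵘ-fromℚᵘ (mkℚᵘ (+ A) B)

  toℚᵘ-scaled : ∀ A B x → toℚᵘ (+ A / suc B ℚ.* ℕ→ℚ x) ℚᵘ.≃ mkℚᵘ (+ A) B ℚᵘ.* mkℚᵘ (+ x) 0
  toℚᵘ-scaled A B x = ℚᵘₚ.≃-trans (ℚₚ.toℚᵘ-homo-* (+ A / suc B) (ℕ→ℚ x)) (ℚᵘₚ.*-cong (toℚᵘ-/ A B) (toℚᵘ-/ x 0))

scaled-≤ : ∀ A B .{{_ : ℕ.NonZero B}} x y → + A * + x ≤ + y * + B → (+ A / B) ℚ.* ℕ→ℚ x ℚ.≤ ℕ→ℚ y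
scaled-≤ A (suc B) x y p = ℚₚ.toℚᵘ-cancel-≤ (ℚᵘₚ.≤-respˡ-≃ (ℚᵘₚ.≃-sym (toℚᵘ-scaled A B x)) (ℚᵘₚ.≤-respʳ-≃ (ℚᵘₚ.≃-sym (toℚᵘ-/ y 0))
  (ℚᵘ.*≤* (subst₂ _≤_ (sym (*-identityʳ (+ A * + x))) (cong (λ m → + y * + m) (sym (ℕₚ.*-identityʳ (suc B)))) p))))

≤-scaled : ∀ A B .{{_ : ℕ.NonZero B}} x y → + y * + B ≤ + A * + x → ℕ→ℚ y ℚ.≤ (+ A / B) ℚ.* ℕ→ℚ x
≤-scaled A (suc B) x y p = ℚₚ.toℚᵘ-cancel-≤ (ℚᵘₚ.≤-respʳ-≃ (ℚᵘₚ.≃-sym (toℚᵘ-scaled A B x)) (ℚᵘₚ.≤-respˡ-≃ (ℚᵘₚ.≃-sym (toℚᵘ-/ y 0))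
  (ℚᵘ.*≤* (subst₂ _≤_ (cong (λ m → + y * + m) (sym (ℕₚ.*-identityʳ (suc B)))) (sym (*-identityʳ (+ A * + x))) p))))

fraction-< : ∀ A B A′ B′ .{{_ : ℕ.NonZero B}} .{{_ : ℕ.NonZero B′}} → + A * + B′ < + A′ * + B → (+ A / B) ℚ.< (+ A′ / B′)
fraction-< A (suc B) A′ (suc B′) p = ℚₚ.toℚᵘ-cancel-< (ℚᵘₚ.<-respˡ-≃ (ℚᵘₚ.≃-sym (toℚᵘ-/ A B)) (ℚᵘₚ.<-respʳ-≃ (ℚᵘₚ.≃-sym (toℚᵘ-/ A′ B′)) (ℚᵘ.*<* p)))

fraction-<-+ : ∀ A B p d .(cop : Coprime (suc p) (suc d)) .{{_ : ℕ.NonZero B}} → + A * + (9 ℕ.* suc d) < (+ 4 * + suc d + + suc p * + 9) * + B →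
  (+ A / B) ℚ.< (+ 4 / 9) ℚ.+ mkℚ (+ suc p) d cop
fraction-<-+ A (suc B) p d cop lt = ℚₚ.toℚᵘ-cancel-< (ℚᵘₚ.<-respˡ-≃ (ℚᵘₚ.≃-sym (toℚᵘ-/ A B))
  (ℚᵘₚ.<-respʳ-≃ (ℚᵘₚ.≃-sym (ℚᵘₚ.≃-trans (ℚₚ.toℚᵘ-homo-+ (+ 4 / 9) (mkℚ (+ suc p) d cop))
    (ℚᵘₚ.+-cong (toℚᵘ-/ 4 8) (ℚᵘₚ.≃-refl {mkℚᵘ (+ suc p) d})))) (ℚᵘ.*<* lt)))

module _ (D n : ℕ) .{{_ : ℕ.NonZero n}} .{{_ : ℕ.NonZero D}} (n≡ : n ≡ D ℕ.+ 2) where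

  open Density D n n≡

  private instance
    s³≢0 : ℕ.NonZero (s³ ℕ.* 9)
    s³≢0 = ℕ.>-nonZero (ℕₚ.<-≤-trans ℕ.z<s (ℕₚ.*-mono-≤ (ℕₚ.*-mono-≤ (ℕₚ.*-mono-≤ 1≤s 1≤s) 1≤s) (ℕ.s≤s {n = 8} ℕ.z≤n)))
      where
      1≤s : 1 ℕ.≤ s
      1≤s = ℕₚ.≤-trans (ℕ.s≤s ℕ.z≤n) (ℕₚ.m≤n+m 3 (2 ℕ.* D))
    D≢0 : ℕ.NonZero (D ℕ.* 18)
    D≢0 = ℕₚ.m*n≢0 D 18

  -- These are `4/9 + 2/(9s³)` and `4/9 + 1/(2D)`.
  lowerDensity upperDensity : ℚ
  lowerDensity = + (s³ ℕ.* 4 ℕ.+ 2) / (s³ ℕ.* 9)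
  upperDensity = + (D ℕ.* 8 ℕ.+ 9) / (D ℕ.* 18)

  4/9<lowerDensity : + 4 / 9 ℚ.< lowerDensity
  4/9<lowerDensity = fraction-< 4 9 (s³ ℕ.* 4 ℕ.+ 2) (s³ ℕ.* 9) (suc[i]≤j⇒i<j (≤-by _
      (trans (cong₂ (λ x y → (x + + 2) * + 9 - (1ℤ + + 4 * y)) (pos-* s³ 4) (pos-* s³ 9)) (eq (+ s³))) (nn 17)))
    where
    eq : ∀ x → (x * + 4 + + 2) * + 9 - (1ℤ + + 4 * (x * + 9)) ≡ + 17
    eq = solve-∀

  threshold : ℕ
  threshold = large ℕ.* block ℕ.+ (4 ℕ.* D ℕ.+ 4)

  densityIn : ∀ v → threshold ℕ.≤ v →
    (∃[ H ] Free (NotColourable n) {v} H × (lowerDensity ℚ.* ℕ→ℚ (v C 3) ℚ.≤ ℕ→ℚ ∣ H ∣ₑ)) ×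
    ((H : Graph3 v) → Free (NotColourable n) H → ℕ→ℚ ∣ H ∣ₑ ℚ.≤ upperDensity ℚ.* ℕ→ℚ (v C 3))
  densityIn v v≥ =
    (lowerGraph v v-large , lowerGraph-free v v-large ,
      scaled-≤ (s³ ℕ.* 4 ℕ.+ 2) (s³ ℕ.* 9) (v C 3) ∣ lowerGraph v v-large ∣ₑ (subst₂ _≤_
        (cong (λ x → x * + (v C 3)) (trans (cong (λ x → x * + 4 + + 2) (sym cube≡ℤ)) (cong (_+ + 2) (sym (pos-* s³ 4)))))
        (cong (+ ∣ lowerGraph v v-large ∣ₑ *_) (trans (cong (_* + 9) (sym cube≡ℤ)) (sym (pos-* s³ 9))))
        (lowerGraph-size v v-large))) ,
    λ H free → ≤-scaled (D ℕ.* 8 ℕ.+ 9) (D ℕ.* 18) (v C 3) ∣ H ∣ₑ (subst₂ _≤_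
        (cong (+ ∣ H ∣ₑ *_) (sym (pos-* D 18)))
        (cong (λ x → (x + + 9) * + (v C 3)) (sym (pos-* D 8)))
        (upper-size v (ℕₚ.≤-trans (ℕₚ.m≤n+m (4 ℕ.* D ℕ.+ 4) (large ℕ.* block)) v≥) H free))
    where
    v-large : large ℕ.* block ℕ.≤ v
    v-large = ℕₚ.≤-trans (ℕₚ.m≤m+n (large ℕ.* block) (4 ℕ.* D ℕ.+ 4)) v≥

theorem1p1 : NonJump (+ 4 / 9)
theorem1p1 (mkℚ (+ zero) d _)   (ℚ.*<* (+<+ ()))
theorem1p1 (mkℚ -[1+ _ ] d _)   (ℚ.*<* ())
theorem1p1 (mkℚ (+ suc p) d cop) _ =
  -- Here `c = (p + 1)/D` is at least `1/D`, which exceeds the `1/(2D)` of the upper density; so the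
  -- denominator alone determines how many cells are enough.
  witness (suc d ℕ.+ 2) refl
  where
  D = suc d
  witness : ∀ n .{{_ : ℕ.NonZero n}} → n ≡ D ℕ.+ 2 →
    ∃[ 𝓕 ] NonEmpty 𝓕 × TuranDensityIn 𝓕 (+ 4 / 9) (+ 4 / 9 ℚ.+ mkℚ (+ suc p) d cop)
  witness n n≡ = NotColourable n , (6 , complete₆ , complete₆-uncolourable n (Density.3≤n D n n≡)) ,
    lowerDensity D n n≡ , upperDensity D n n≡ , threshold D n n≡ , 4/9<lowerDensity D n n≡ ,
    fraction-<-+ (D ℕ.* 8 ℕ.+ 9) (D ℕ.* 18) p d cop {{ℕₚ.m*n≢0 D 18}} (suc[i]≤j⇒i<j (≤-by _
      (trans (cong₂ (λ x y → (+ 4 * + D + + suc p * + 9) * x - (1ℤ + y)) (pos-* D 18)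
               (cong₂ _*_ (cong (_+ + 9) (pos-* D 8)) (pos-* 9 D)))
             (eq (+ d) (+ p)))
      (nn p ⊗ (nn d ⊕ nn 1) ⊗ nn 162 ⊕ (nn d ⊗ nn 81 ⊕ nn 80)))) ,
    densityIn D n n≡
    where
    eq : ∀ d p → let D = 1ℤ + d in
      (+ 4 * D + (1ℤ + p) * + 9) * (D * + 18) - (1ℤ + (D * + 8 + + 9) * (+ 9 * D))
      ≡ p * (d + + 1) * + 162 + (d * + 81 + + 80)
    eq = solve-∀
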